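{- If $(\mathcal K,\mathcal K')$ is a shifted family pair, then $$\mathbf s(\mathcal K,\mathcal K')\circeq \mathbf d(\mathcal K,\mathcal K')^T .$$ That is, the multiset of non-zero eigenvalues (with multiplicity) of the Laplacian $L(\mathcal K,\mathcal K')$ equals the multiset of non-zero parts of the conjugate of the degree sequence $\mathbf d(\mathcal K,\mathcal K')$.
   Context: A $k$-family on a finite ground set $E$ of integers is a collection of $k$-subsets of $E$. For a $k$-family $\mathcal K$, the unsigned boundary $\operatorname{bd}\mathcal K$ is the $(k-1)$-family of all $(k-1)$-subsets of members of $\mathcal K$. A family pair $(\mathcal K,\mathcal K')$ consists of a $k$-family $\mathcal K$ and a $(k-1)$-family $\mathcal K'$ on the same ground set (for some $k\ge 1$), where $(\mathcal K,\mathcal K')$ and $(\mathcal K,\mathcal K'')$ are identified whenever $(\operatorname{bd}\mathcal K)\cap\mathcal K'=(\operatorname{bd}\mathcal K)\cap\mathcal K''$. For $k$-subsets $F=\{f_1<\cdots<f_k\}$, $G=\{g_1<\cdots<g_k\}$ of $E$ write $F\le_P G$ if $f_p\le g_p$ for all $p$; a $k$-family $\mathcal K$ is shifted if $F\le_P G$ and $G\in\mathcal K$ imply $F\in\mathcal K$. The pair $(\mathcal K,\mathcal K')$ is a shifted family pair if $\mathcal K$ is shifted and $(\mathcal K,\mathcal K')=(\mathcal K,\mathcal K'')$ for some $\mathcal K''$ that is shifted on the same ordered ground set. $C(\mathcal K;\mathbb R)$ is the real vector space of formal linear combinations of oriented faces $[F]$, $F\in\mathcal K$. The boundary operator $\partial_{(\mathcal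 K,\mathcal K')}\colon C(\mathcal K;\mathbb R)\to C((\operatorname{bd}\mathcal K)\setminus\mathcal K';\mathbb R)$ is the usual signed simplicial boundary with the sum restricted to faces in $(\operatorname{bd}\mathcal K)\setminus\mathcal K'$; $\partial^*_{(\mathcal K,\mathcal K')}$ is its adjoint (transposed matrix in the natural bases). The Laplacian is $L(\mathcal K,\mathcal K')=\partial^*_{(\mathcal K,\mathcal K')}\partial_{(\mathcal K,\mathcal K')}$, and $\mathbf s(\mathcal K,\mathcal K')$ is its multiset of eigenvalues in weakly decreasing order. For $\lambda\in E$, the degree is $d_\lambda(\mathcal K,\mathcal K')=|\{F\in\mathcal K:\lambda\in F,\ F\setminus\{\lambda\}\notin\mathcal K'\}|$, and the degree sequence $\mathbf d(\mathcal K,\mathcal K')$ is the partition whose parts are the numbers $d_\lambda(\mathcal K,\mathcal K')$, $\lambda\in E$. $\boldsymbol\lambda^T$ denotes the conjugate (transpose) of a partition $\boldsymbol\lambda$, and $\circeq$ means that two multisets agree in the multiplicities of all non-zero elements. -}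

module Defs where

open import Algebra.Apartness.Bundles using (HeytingField; HeytingCommutativeRing)
open import Algebra.Bundles using (CommutativeRing; Semiring)
import Algebra.Definitions.RawSemiring as RawSemiringOps
open import Data.Bool.Base using (Bool; T; not; _∧_; if_then_else_)
open import Data.Bool.Properties as Bool using (T?; T-∧)
open import Data.Fin.Base as Fin using (Fin)
open import Data.Fin.Subset using (Subset; inside; outside; _⊆_; ∣_∣) renaming (_-_ to _without_)
open import Data.Fin.Properties using (_<?_)
open import Data.Fin.Subset.Properties using (_∈?_; _⊆?_; anySubset?)
open import Data.Integer.Base as ℤ using (ℤ)
open import Data.List.Base using (List; []; _∷_; _++_; map; filter; filterᵇ; length; lookup; allFin; upTo)
open import Data.List.Extrema.Nat using (max)
open import Data.List.Relation.Binary.Pointwise using (Pointwise)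
open import Data.List.Relation.Unary.Linked using (Linked)
import Data.List.Sort as Sort
open import Data.Nat.Base as ℕ using (ℕ; zero; suc)
open import Data.Nat.Properties as ℕ using ()
open import Data.Product.Base using (∃-syntax; _×_; _,_; proj₁)
open import Data.Sum.Base using (_⊎_)
import Data.Vec.Base as Vec
open import Data.Vec.Functional using (Vector)
open import Data.Vec.Properties using (≡-dec)
open import Function.Bundles using (_⇔_; Equivalence)
open import Level using (_⊔_) renaming (suc to lsuc)
import Relation.Binary.Construct.Flip.EqAndOrd as Flip
open import Relation.Binary.Core using (Rel)
open import Relation.Binary.PropositionalEquality.Core using (_≡_)
open import Relation.Binary.Structures using (IsStrictPartialOrder)
open import Relation.Nullary.Decidable using (Dec; ⌊_⌋; toWitness; _×-dec_)
open import Relation.Nullary.Negation using (¬_)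
open import Relation.Unary using (Pred)

-- A finite set of integers, listed in increasing order.  A subset of it is
-- given by the set of positions of its elements.
record GroundSet : Set where
  field
    size       : ℕ
    element    : Fin size → ℤ
    increasing : ∀ {i j} → i Fin.< j → element i ℤ.< element j

record Family (n k : ℕ) : Set where
  field
    member  : Subset n → Bool
    uniform : ∀ {F} → T (member F) → ∣ F ∣ ≡ k

open Family public

infix 4 _∈ᶠ_

_∈ᶠ_ : ∀ {n k} → Subset n → Family n k → Set
F ∈ᶠ K = T (member K F)

subsets : ∀ n → List (Subset n)
subsets zero    = Vec.[] ∷ []
subsets (suc n) = map (outside Vec.∷_) (subsets n) ++ map (inside Vec.∷_) (subsets n)

-- Each member of K occurs exactly once in this list.
faces : ∀ {n k} → Family n k → List (Subset n)
faces {n} K = filterᵇ (member K) (subsets n)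

card : ∀ {n k} → Family n k → ℕ
card K = length (faces K)

face : ∀ {n k} (K : Family n k) → Fin (card K) → Subset n
face K = lookup (faces K)

module _ {n k : ℕ} where

  bd : Family n (suc k) → Family n k
  bd K = record
    { member  = λ G → ⌊ member? G ⌋
    ; uniform = λ {G} G∈ → proj₁ (toWitness {a? = member? G} G∈)
    }
    where
    member? : ∀ G → Dec (∣ G ∣ ≡ k × ∃[ F ] (F ∈ᶠ K × G ⊆ F))
    member? G = (∣ G ∣ ℕ.≟ k) ×-dec anySubset? (λ F → T? (member K F) ×-dec (G ⊆? F))

  infixl 5 _∖_
  _∖_ : Family n k → Family n k → Family n k
  K ∖ K′ = record
    { member  = λ F → member K F ∧ not (member K′ F)
    ; uniform = λ F∈ → uniform K (proj₁ (Equivalence.to T-∧ F∈))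
    }

  -- The identification of (K , K′) with (K , K″) as family pairs.
  SamePair : Family n (suc k) → Family n k → Family n k → Set
  SamePair K K′ K″ = ∀ G → (G ∈ᶠ bd K × G ∈ᶠ K′) ⇔ (G ∈ᶠ bd K × G ∈ᶠ K″)

positions : ∀ {n} → Subset n → List (Fin n)
positions {n} F = filter (_∈? F) (allFin n)

module _ (E : GroundSet) where
  open GroundSet E

  infix 4 _≤P_

  -- Pointwise forces the two sets to have the same cardinality.
  _≤P_ : Subset size → Subset size → Set
  F ≤P G = Pointwise ℤ._≤_ (map element (positions F)) (map element (positions G))

  Shifted : ∀ {k} → Family size k → Set
  Shifted K = ∀ F G → F ≤P G → G ∈ᶠ K → F ∈ᶠ K

  IsShiftedPair : ∀ {k} → Family size (suc k) → Family size k → Set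
  IsShiftedPair K K′ = Shifted K × ∃[ K″ ] (SamePair K K′ K″ × Shifted K″)

degree : ∀ {n k} → Family n (suc k) → Family n k → Fin n → ℕ
degree K K′ v =
  length (filter (v ∈?_) (filterᵇ (λ F → not (member K′ (F without v))) (faces K)))

-- Partitions are weakly decreasing lists, possibly with trailing zeros.
degreeSequence : ∀ {n k} → Family n (suc k) → Family n k → List ℕ
degreeSequence {n} K K′ = sort (map (degree K K′) (allFin n))
  where open Sort (Flip.decTotalOrder ℕ.≤-decTotalOrder) using (sort)

-- The j-th part of the conjugate (j ≥ 1) is the number of parts that are ≥ j.
conjugate : List ℕ → List ℕ
conjugate ds = map (λ j → length (filter (suc j ℕ.≤?_) ds)) (upTo (max 0 ds))

module Chains {c ℓ} (R : CommutativeRing c ℓ) where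
  open CommutativeRing R
  open RawSemiringOps (Semiring.rawSemiring semiring) public using (sum; _^_)

  -- A p × q matrix; it acts on column vectors of length q.
  Matrix : ℕ → ℕ → Set c
  Matrix p q = Fin p → Fin q → Carrier

  transpose : ∀ {p q} → Matrix p q → Matrix q p
  transpose M j i = M i j

  infixl 7 _⊛_
  _⊛_ : ∀ {p q r} → Matrix p q → Matrix q r → Matrix p r
  (M ⊛ N) i l = sum (λ j → M i j * N j l)

  infixr 7 _▹_
  _▹_ : ∀ {p q} → Matrix p q → Vector Carrier q → Vector Carrier p
  (M ▹ v) i = sum (λ j → M i j * v j)

  -- (-1)ᵖ, where p is the number of elements of F below v.
  sign : ∀ {n} → Subset n → Fin n → Carrier
  sign F v = (- 1#) ^ length (filter (_<? v) (positions F))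

  -- The coefficient of [G] in  ∂[F] = Σ_{v ∈ F} sign F v · [F ∖ v],
  -- every face being oriented by the order of its elements.
  incidence : ∀ {n} → Subset n → Subset n → Carrier
  incidence G F =
    sum (λ v → if ⌊ (v ∈? F) ×-dec ≡-dec Bool._≟_ (F without v) G ⌋ then sign F v else 0#)

  -- The matrix, in the bases of oriented faces, of
  -- ∂ : C(K) → C(bd K ∖ K′).
  boundary : ∀ {n k} (K : Family n (suc k)) (K′ : Family n k) →
             Matrix (card (bd K ∖ K′)) (card K)
  boundary K K′ i j = incidence (face (bd K ∖ K′) i) (face K j)

  laplacian : ∀ {n k} (K : Family n (suc k)) (K′ : Family n k) →
              Matrix (card K) (card K)
  laplacian K K′ = transpose (boundary K K′) ⊛ boundary K K′

-- The real numbers, axiomatised as a Cauchy complete Archimedean ordered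
-- field.  The field is a Heyting field, with apartness  x < y ⊎ y < x,  so
-- that the axioms hold for the reals constructively as well as classically.

record Reals c ℓ₁ ℓ₂ : Set (lsuc (c ⊔ ℓ₁ ⊔ ℓ₂)) where
  field
    heytingField : HeytingField c ℓ₁ ℓ₂

  open HeytingField heytingField public

  commutativeRing : CommutativeRing c ℓ₁
  commutativeRing = HeytingCommutativeRing.commutativeRing heytingCommutativeRing

  open RawSemiringOps (Semiring.rawSemiring (CommutativeRing.semiring commutativeRing))
    using () renaming (_×_ to _·_)

  fromℕ : ℕ → Carrier
  fromℕ n = n · 1#

  infix 4 _<_ _≥_
  field
    _<_                  : Rel Carrier ℓ₂
    isStrictPartialOrder : IsStrictPartialOrder _≈_ _<_
    #⇔<                  : ∀ {x y} → x # y ⇔ (x < y ⊎ y < x)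
    +-monoˡ-<            : ∀ {x y} z → x < y → x + z < y + z
    *-pos                : ∀ {x y} → 0# < x → 0# < y → 0# < x * y
    archimedean          : ∀ x → ∃[ n ] x < fromℕ n

  _≥_ : Rel Carrier ℓ₂
  x ≥ y = ¬ (x < y)

  Cauchy : (ℕ → Carrier) → Set ℓ₂
  Cauchy u = ∀ k → ∃[ N ] ∀ m n → N ℕ.≤ m → N ℕ.≤ n →
             suc k · (u m - u n) < 1#

  ConvergesTo : (ℕ → Carrier) → Carrier → Set ℓ₂
  ConvergesTo u x = ∀ k → ∃[ N ] ∀ n → N ℕ.≤ n →
                    suc k · (u n - x) < 1# × suc k · (x - u n) < 1#

  field
    complete : ∀ u → Cauchy u → ∃[ x ] ConvergesTo u x

module Spectra {c ℓ₁ ℓ₂} (ℝ : Reals c ℓ₁ ℓ₂) where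
  open Reals ℝ
  open Chains commutativeRing public

  -- Mult x xs m:  x occurs exactly m times in xs.  A relation, as equality of
  -- reals is not decidable.
  data Mult (x : Carrier) : List Carrier → ℕ → Set (c ⊔ ℓ₁) where
    []   : Mult x [] 0
    hit  : ∀ {y ys m} → x ≈ y → Mult x ys m → Mult x (y ∷ ys) (suc m)
    miss : ∀ {y ys m} → ¬ (x ≈ y) → Mult x ys m → Mult x (y ∷ ys) m

  infix 4 _≗_
  _≗_ : List Carrier → List Carrier → Set (c ⊔ ℓ₁ ⊔ ℓ₂)
  xs ≗ ys = ∀ x → x # 0# → ∀ m → Mult x xs m ⇔ Mult x ys m

  record HasDimension {n ℓ} (V : Pred (Vector Carrier n) ℓ) (m : ℕ) : Set (c ⊔ ℓ₁ ⊔ ℓ) where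
    combination : (Fin m → Vector Carrier n) → Vector Carrier m → Vector Carrier n
    combination b a i = sum (λ j → a j * b j i)

    field
      basis       : Fin m → Vector Carrier n
      basis⊆V     : ∀ j → V (basis j)
      independent : ∀ a → (∀ i → combination basis a i ≈ 0#) → ∀ j → a j ≈ 0#
      spanning    : ∀ v → V v → ∃[ a ] ∀ i → v i ≈ combination basis a i

  Eigenspace : ∀ {n} → Matrix n n → Carrier → Pred (Vector Carrier n) ℓ₁
  Eigenspace M x v = ∀ i → (M ▹ v) i ≈ x * v i

  -- s is the multiset of eigenvalues of M, in weakly decreasing order; an
  -- eigenvalue is repeated as often as the dimension of its eigenspace.  For
  -- symmetric M this is also its algebraic multiplicity, and there are as many
  -- eigenvalues as rows.
  record IsSpectrum {n} (M : Matrix n n) (s : List Carrier) : Set (c ⊔ ℓ₁ ⊔ ℓ₂) where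
    field
      decreasing   : Linked _≥_ s
      total        : length s ≡ n
      multiplicity : ∀ x m → Mult x s m ⇔ HasDimension (Eigenspace M x) m

-- Split off the smallest vertex 0.  Let A and B be the boundary matrices of the
-- deletion and of the contraction of (K , K′), and let 1 be the projection onto
-- the faces in M = K / 0 ∖ (K′ − 0).  Shiftedness gives 1 A = A, B 1 = B and
-- B A = 0, so the boundary matrix of (K , K′) factors as Y Xᵀ with X = (Aᵀ ; 1)
-- and Y = (1 ; - B).  Hence L = X (Yᵀ Y) Xᵀ has the same non-zero eigenvalues as
-- (Xᵀ X) (Yᵀ Y) = 1 + A Aᵀ + Bᵀ B.  The last two summands annihilate each other,
-- so these eigenvalues are the non-zero ones of the two smaller Laplacians, raised
-- by one, and otherwise 1.
--
-- Carried out on spectral projections, the recursion shows that the projection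
-- for the eigenvalue a + 1 has trace d a - d (a + 1), where d a is the degree of
-- the vertex a.  Over a local ring the image of an idempotent matrix is free,
-- and its dimension is the trace.  In particular d is weakly
-- decreasing, and d a - d (a + 1) is the multiplicity of a + 1 in the conjugate.

module Submission where

open import Defs
open import Algebra.Bundles using (CommutativeRing)
import Algebra.Apartness.Properties.HeytingCommutativeRing as HeytingProperties
import Algebra.Definitions.RawMonoid as RawMonoidOps
import Algebra.Properties.CommutativeSemigroup as CommutativeSemigroupProperties
import Algebra.Properties.Group as GroupProperties
import Algebra.Properties.Monoid.Mult as MonoidMult
import Algebra.Properties.Ring as RingProperties
import Algebra.Properties.Semiring.Sum as SemiringSum
open import Data.Bool.Base using (Bool; true; false; T; not; _∧_; if_then_else_)
open import Data.Bool.Properties as Bool using (T-∧; T?; ∧-comm; ∧-zeroʳ)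
open import Data.Empty using (⊥-elim)
open import Data.Fin.Base as Fin using (Fin)
open import Data.Fin.Properties using (_<?_)
open import Data.Fin.Subset using (Subset; inside; outside; _∈_; _⊆_; ∣_∣) renaming (_-_ to _without_)
open import Data.Fin.Subset.Properties using (_∈?_; p─⊥≡p; s⊆s; out⊆)
open import Data.Integer.Base as ℤ using (ℤ)
import Data.Integer.Properties as ℤ
open import Data.List.Base
  using (List; []; _∷_; _++_; map; filter; filterᵇ; length; lookup; allFin; tabulate; applyUpTo)
open import Data.List.Extrema.Nat using (max; max≤v⁺; v≤max⁺)
open import Data.List.Membership.Propositional using () renaming (_∈_ to _∈ˡ_)
open import Data.List.Membership.Propositional.Properties using (∈-lookup)
open import Data.List.Properties
  using (filter-++; filter-accept; filter-none; filter-reject; length-++; length-applyUpTo; length-filter;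
         length-map; map-++; map-cong; map-tabulate; map-upTo; map-∘)
open import Data.List.Relation.Binary.Permutation.Propositional using (_↭_; ↭-reflexive; ↭-sym; ↭-trans)
open import Data.List.Relation.Binary.Permutation.Propositional.Properties
  using (All-resp-↭; Any-resp-↭; filter-↭; ↭-length)
open import Data.List.Relation.Binary.Pointwise as Pointwise using (Pointwise; []; _∷_)
open import Data.List.Relation.Unary.All as All using (All; []; _∷_)
import Data.List.Relation.Unary.All.Properties as Allₚ
open import Data.List.Relation.Unary.Any using (Any; here; there)
import Data.List.Relation.Unary.Linked.Properties as Linkedₚ
import Data.List.Sort as Sort
open import Data.Nat.Base as ℕ using (ℕ; zero; suc)
import Data.Nat.Properties as ℕ
open import Data.Product.Base using (_,_; _×_; ∃-syntax; proj₁; proj₂)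
open import Data.Sum.Base using (_⊎_; inj₁; inj₂; [_,_]′)
open import Data.Unit.Base using (tt)
open import Data.Vec.Base using ([]; _∷_; here; there)
open import Data.Vec.Functional using (Vector)
open import Data.Vec.Properties using (≡-dec; ∷-injectiveʳ)
open import Function.Base using (_∘_; id)
open import Function.Bundles using (_⇔_; Equivalence; mk⇔)
open import Level using (_⊔_) renaming (suc to lsuc)
open import Relation.Binary.Bundles using (Setoid)
import Relation.Binary.Construct.Flip.EqAndOrd as Flip
open import Relation.Binary.Definitions using (tri<; tri≈; tri>)
open import Relation.Binary.PropositionalEquality as ≡ using (_≡_)
import Relation.Binary.Reasoning.Setoid as SetoidReasoning
open import Relation.Binary.Structures using (IsStrictPartialOrder)
open import Relation.Nullary.Decidable using (Dec; yes; no; does; ⌊_⌋; _×-dec_; fromWitness)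
open import Relation.Nullary.Negation using (¬_; contradiction)
open import Relation.Unary using (Pred; Decidable)

-- Equality of reals is undecidable, so neither eigenvectors nor ranks can be found by elimination
-- that tests entries for zero. The recursion therefore carries explicit matrices: the matrix for
-- the eigenvalue a + 1 is obtained from those of the two smaller pairs by ring operations and
-- inverses of positive integers alone. Only the eigen equations on both sides, completeness and the
-- traces are carried along. Idempotence comes last: together with the kernel part the family sums
-- to 1, and on the columns of one member all others vanish, because distinct integers are apart.
-- Only then is a rank extracted; an idempotent can always be pivoted, since x or 1 - x is
-- invertible for its corner entry x. Matrices are indexed by all subsets and extended by zero, so
-- that deletion and contraction, whose faces differ in size, share one index set. The trace
-- identities are written as sums, because degrees are natural numbers whose monotonicity is a
-- consequence of these identities; characteristic zero turns them into identities of natural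
-- numbers.

infixr 5 _◂_
_◂_ : ℕ → (ℕ → ℕ) → ℕ → ℕ
(x ◂ f) zero    = x
(x ◂ f) (suc a) = f a

-- Matrices over finite index types, and families of eigenmatrices.

module Matrices {c ℓ} (R : CommutativeRing c ℓ) where
  open CommutativeRing R
  open RingProperties ring using (-‿distribˡ-*)
  open SemiringSum semiring
  open CommutativeSemigroupProperties +-commutativeSemigroup using (interchange)
  open MonoidMult +-monoid using (×-homo-+)
  open RawMonoidOps +-rawMonoid using () renaming (_×_ to _×′_)

  ι : ℕ → Carrier
  ι n = n ×′ 1#

  -- `sum-δ` does duty for the statement that `enum` meets every index exactly once. The Kronecker
  -- symbol takes values in the ring, so matrix identities involve no decision of equality between
  -- indices.
  record Index : Set (lsuc c ⊔ ℓ) where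
    field
      El     : Set
      {size} : ℕ
      enum   : Fin size → El
      δ      : El → El → Carrier

    field
      δ-refl : ∀ i → δ i i ≈ 1#
      δ-sym  : ∀ i j → δ i j ≈ δ j i
      sum-δ  : ∀ i (f : El → Carrier) → sum (λ j → δ i (enum j) * f (enum j)) ≈ f i

    abstract
      ∑ : (El → Carrier) → Carrier
      ∑ f = sum (f ∘ enum)

      ∑-sum : ∀ f → ∑ f ≈ sum (f ∘ enum)
      ∑-sum f = refl

      ∑-cong : ∀ {f g} → (∀ i → f i ≈ g i) → ∑ f ≈ ∑ g
      ∑-cong eq = sum-cong-≋ (λ i → eq (enum i))

      ∑-+ : ∀ f g → ∑ (λ i → f i + g i) ≈ ∑ f + ∑ g
      ∑-+ f g = ∑-distrib-+ (f ∘ enum) (g ∘ enum)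

      ∑-*ˡ : ∀ x f → ∑ (λ i → x * f i) ≈ x * ∑ f
      ∑-*ˡ x f = sym (*-distribˡ-sum x (f ∘ enum))

      ∑-*ʳ : ∀ x f → ∑ (λ i → f i * x) ≈ ∑ f * x
      ∑-*ʳ x f = sym (*-distribʳ-sum x (f ∘ enum))

      ∑-0 : ∀ {f} → (∀ i → f i ≈ 0#) → ∑ f ≈ 0#
      ∑-0 eq = trans (∑-cong eq) (sum-replicate-zero size)

      ∑-δ : ∀ i (f : El → Carrier) → ∑ (λ j → δ i j * f j) ≈ f i
      ∑-δ = sum-δ

  open Index

  private variable
    I J K L : Index

  ∑-swap : ∀ I J (f : El I → El J → Carrier) →
           ∑ I (λ i → ∑ J (λ j → f i j)) ≈ ∑ J (λ j → ∑ I (λ i → f i j))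
  ∑-swap I J f =
    trans (∑-sum I _)
    (trans (sum-cong-≋ {x = λ i → ∑ J (f (enum I i))} λ i → ∑-sum J (f (enum I i)))
    (trans (∑-comm (λ i j → f (enum I i) (enum J j)))
    (trans (sum-cong-≋ {y = λ j → ∑ I (λ i → f i (enum J j))} λ j → sym (∑-sum I _))
           (sym (∑-sum J _)))))

  record Mat (I J : Index) : Set c where
    constructor mat
    field at : El I → El J → Carrier

  open Mat public

  infix 4 _≋_
  record _≋_ {I J} (M N : Mat I J) : Set (c ⊔ ℓ) where
    constructor pointwise
    field entry : ∀ i j → at M i j ≈ at N i j

  open _≋_ public

  ≋-setoid : ∀ I J → Setoid c (c ⊔ ℓ)
  ≋-setoid I J = record
    { Carrier = Mat I J
    ; _≈_     = _≋_
    ; isEquivalence = record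
      { refl  = pointwise λ _ _ → refl
      ; sym   = λ p → pointwise λ i j → sym (entry p i j)
      ; trans = λ p q → pointwise λ i j → trans (entry p i j) (entry q i j)
      }
    }

  module _ {I J : Index} where
    open Setoid (≋-setoid I J) public
      using () renaming (refl to ≋-refl; sym to ≋-sym; trans to ≋-trans)
    open SetoidReasoning (≋-setoid I J) public

  infixl 7 _·_
  infixr 8 _⊛_
  infixl 6 _⊕_ _⊖_
  infix  9 _ᵀ

  _·_ : Mat I J → Mat J K → Mat I K
  _·_ {J = J} M N = mat λ i k → ∑ J (λ j → at M i j * at N j k)

  _⊕_ _⊖_ : Mat I J → Mat I J → Mat I J
  M ⊕ N = mat λ i j → at M i j + at N i j
  M ⊖ N = mat λ i j → at M i j - at N i j

  _⊛_ : Carrier → Mat I J → Mat I J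
  x ⊛ M = mat λ i j → x * at M i j

  _ᵀ : Mat I J → Mat J I
  M ᵀ = mat λ j i → at M i j

  𝟘 : Mat I J
  𝟘 = mat λ _ _ → 0#

  diag : (El I → Carrier) → Mat I I
  diag {I} p = mat λ i j → p i * δ I i j

  𝟙 : Mat I I
  𝟙 {I} = mat (δ I)

  tr : Mat I I → Carrier
  tr {I} M = ∑ I (λ i → at M i i)

  ΣM : ℕ → (ℕ → Mat I J) → Mat I J
  ΣM zero    f = 𝟘
  ΣM (suc n) f = f 0 ⊕ ΣM n (f ∘ suc)

  ·-cong : {M M′ : Mat I J} {N N′ : Mat J K} → M ≋ M′ → N ≋ N′ → M · N ≋ M′ · N′
  ·-cong {J = J} p q = pointwise λ i k → ∑-cong J λ j → *-cong (entry p i j) (entry q j k)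

  ·-congˡ : {M : Mat I J} {N N′ : Mat J K} → N ≋ N′ → M · N ≋ M · N′
  ·-congˡ = ·-cong ≋-refl

  ·-congʳ : {M M′ : Mat I J} {N : Mat J K} → M ≋ M′ → M · N ≋ M′ · N
  ·-congʳ p = ·-cong p ≋-refl

  ⊕-cong : {M M′ N N′ : Mat I J} → M ≋ M′ → N ≋ N′ → M ⊕ N ≋ M′ ⊕ N′
  ⊕-cong p q = pointwise λ i j → +-cong (entry p i j) (entry q i j)

  ⊖-cong : {M M′ N N′ : Mat I J} → M ≋ M′ → N ≋ N′ → M ⊖ N ≋ M′ ⊖ N′
  ⊖-cong p q = pointwise λ i j → +-cong (entry p i j) (-‿cong (entry q i j))

  ⊛-cong : ∀ {x y} {M N : Mat I J} → x ≈ y → M ≋ N → x ⊛ M ≋ y ⊛ N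
  ⊛-cong e p = pointwise λ i j → *-cong e (entry p i j)

  ᵀ-cong : {M N : Mat I J} → M ≋ N → M ᵀ ≋ N ᵀ
  ᵀ-cong p = pointwise λ j i → entry p i j

  tr-cong : {M N : Mat I I} → M ≋ N → tr M ≈ tr N
  tr-cong {I} p = ∑-cong I λ i → entry p i i

  ·-assoc : (M : Mat I J) (N : Mat J K) (P : Mat K L) → (M · N) · P ≋ M · (N · P)
  ·-assoc {J = J} {K = K} M N P = pointwise λ i l →
    trans (∑-cong K λ k → sym (∑-*ʳ J (at P k l) _))
    (trans (∑-swap K J _)
    (∑-cong J λ j → trans (∑-cong K λ k → *-assoc _ _ _) (∑-*ˡ K _ _)))

  ·-⊕ : (M : Mat I J) (N P : Mat J K) → M · (N ⊕ P) ≋ M · N ⊕ M · P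
  ·-⊕ {J = J} M N P = pointwise λ i k →
    trans (∑-cong J λ j → distribˡ _ _ _) (∑-+ J _ _)

  ⊕-· : (M N : Mat I J) (P : Mat J K) → (M ⊕ N) · P ≋ M · P ⊕ N · P
  ⊕-· {J = J} M N P = pointwise λ i k →
    trans (∑-cong J λ j → distribʳ _ _ _) (∑-+ J _ _)

  ·-⊛ : ∀ x (M : Mat I J) (N : Mat J K) → M · (x ⊛ N) ≋ x ⊛ (M · N)
  ·-⊛ {J = J} x M N = pointwise λ i k →
    trans (∑-cong J λ j → trans (sym (*-assoc _ _ _)) (trans (*-congʳ (*-comm _ _)) (*-assoc _ _ _)))
          (∑-*ˡ J x _)

  ⊛-· : ∀ x (M : Mat I J) (N : Mat J K) → (x ⊛ M) · N ≋ x ⊛ (M · N)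
  ⊛-· {J = J} x M N = pointwise λ i k →
    trans (∑-cong J λ j → *-assoc _ _ _) (∑-*ˡ J x _)

  ⊖-⊕ : (M N : Mat I J) → M ⊖ N ≋ M ⊕ (- 1#) ⊛ N
  ⊖-⊕ M N = pointwise λ i j → +-congˡ
    (trans (-‿cong (sym (*-identityˡ _))) (-‿distribˡ-* 1# _))

  ·-⊖ : (M : Mat I J) (N P : Mat J K) → M · (N ⊖ P) ≋ M · N ⊖ M · P
  ·-⊖ M N P = begin
    M · (N ⊖ P)                ≈⟨ ·-congˡ (⊖-⊕ N P) ⟩
    M · (N ⊕ (- 1#) ⊛ P)       ≈⟨ ·-⊕ M N _ ⟩
    M · N ⊕ M · ((- 1#) ⊛ P)   ≈⟨ ⊕-cong ≋-refl (·-⊛ _ M P) ⟩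
    M · N ⊕ (- 1#) ⊛ (M · P)   ≈⟨ ⊖-⊕ _ _ ⟨
    M · N ⊖ M · P              ∎

  ⊖-· : (M N : Mat I J) (P : Mat J K) → (M ⊖ N) · P ≋ M · P ⊖ N · P
  ⊖-· M N P = begin
    (M ⊖ N) · P                ≈⟨ ·-congʳ (⊖-⊕ M N) ⟩
    (M ⊕ (- 1#) ⊛ N) · P       ≈⟨ ⊕-· M _ P ⟩
    M · P ⊕ ((- 1#) ⊛ N) · P   ≈⟨ ⊕-cong ≋-refl (⊛-· _ N P) ⟩
    M · P ⊕ (- 1#) ⊛ (N · P)   ≈⟨ ⊖-⊕ _ _ ⟨
    M · P ⊖ N · P              ∎

  ·-𝟘 : (M : Mat I J) → M · 𝟘 ≋ 𝟘 {I} {K}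
  ·-𝟘 {J = J} M = pointwise λ _ _ → ∑-0 J λ _ → zeroʳ _

  𝟘-· : (M : Mat J K) → 𝟘 · M ≋ 𝟘 {I} {K}
  𝟘-· {J = J} M = pointwise λ _ _ → ∑-0 J λ _ → zeroˡ _

  ⊛-𝟘 : ∀ x → x ⊛ 𝟘 ≋ 𝟘 {I} {J}
  ⊛-𝟘 x = pointwise λ _ _ → zeroʳ x

  ⊕-𝟘 : (M : Mat I J) → M ⊕ 𝟘 ≋ M
  ⊕-𝟘 M = pointwise λ _ _ → +-identityʳ _

  𝟘-⊕ : (M : Mat I J) → 𝟘 ⊕ M ≋ M
  𝟘-⊕ M = pointwise λ _ _ → +-identityˡ _

  ⊖-self : (M : Mat I J) → M ⊖ M ≋ 𝟘
  ⊖-self M = pointwise λ _ _ → -‿inverseʳ _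

  ⊛-⊛ : ∀ x y (M : Mat I J) → x ⊛ y ⊛ M ≋ (x * y) ⊛ M
  ⊛-⊛ x y M = pointwise λ _ _ → sym (*-assoc _ _ _)

  1-⊛ : (M : Mat I J) → 1# ⊛ M ≋ M
  1-⊛ M = pointwise λ _ _ → *-identityˡ _

  ⊛-⊕ : ∀ x (M N : Mat I J) → x ⊛ (M ⊕ N) ≋ x ⊛ M ⊕ x ⊛ N
  ⊛-⊕ x M N = pointwise λ _ _ → distribˡ _ _ _

  +-⊛ : ∀ x y (M : Mat I J) → (x + y) ⊛ M ≋ x ⊛ M ⊕ y ⊛ M
  +-⊛ x y M = pointwise λ _ _ → distribʳ _ _ _

  ᵀ-· : (M : Mat I J) (N : Mat J K) → (M · N) ᵀ ≋ N ᵀ · M ᵀ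
  ᵀ-· {J = J} M N = pointwise λ k i → ∑-cong J λ j → *-comm _ _

  diag-· : ∀ p (M : Mat I J) → diag p · M ≋ mat (λ i j → p i * at M i j)
  diag-· {I} p M = pointwise λ i j →
    trans (∑-cong I λ k → *-assoc _ _ _) (trans (∑-*ˡ I _ _) (*-congˡ (∑-δ I i (λ k → at M k j))))

  ·-diag : ∀ p (M : Mat I J) → M · diag p ≋ mat (λ i j → at M i j * p j)
  ·-diag {J = J} p M = pointwise λ i j →
    trans (∑-cong J λ k → trans (sym (*-assoc _ _ _)) (trans (*-comm _ _) (*-congʳ (δ-sym J k j))))
          (∑-δ J j (λ k → at M i k * p k))

  diag-1 : 𝟙 {I} ≋ diag (λ _ → 1#)
  diag-1 = pointwise λ _ _ → sym (*-identityˡ _)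

  𝟙-· : (M : Mat I J) → 𝟙 · M ≋ M
  𝟙-· M = ≋-trans (·-congʳ diag-1) (≋-trans (diag-· _ M) (pointwise λ _ _ → *-identityˡ _))

  ·-𝟙 : (M : Mat I J) → M · 𝟙 ≋ M
  ·-𝟙 M = ≋-trans (·-congˡ diag-1) (≋-trans (·-diag _ M) (pointwise λ _ _ → *-identityʳ _))

  -- Without an equality test on indices, `p j * δ i j` and `p i * δ i j` are compared through the
  -- two ways of evaluating `𝟙 · diag p`.
  diag-ᵀ : ∀ p → (diag {I} p) ᵀ ≋ diag p
  diag-ᵀ {I} p = pointwise λ i j →
    trans (*-congˡ (δ-sym I j i))
    (trans (*-comm _ _) (trans (sym (entry (·-diag p (𝟙 {I})) i j)) (entry (𝟙-· (diag p)) i j)))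

  tr-comm : (M : Mat I J) (N : Mat J I) → tr (M · N) ≈ tr (N · M)
  tr-comm {I} {J} M N =
    trans (∑-swap I J _) (∑-cong J λ j → ∑-cong I λ i → *-comm _ _)

  tr-⊕ : (M N : Mat I I) → tr (M ⊕ N) ≈ tr M + tr N
  tr-⊕ {I} M N = ∑-+ I _ _

  tr-⊛ : ∀ x (M : Mat I I) → tr (x ⊛ M) ≈ x * tr M
  tr-⊛ {I} x M = ∑-*ˡ I _ _

  tr-diag : ∀ p → tr (diag {I} p) ≈ ∑ I p
  tr-diag {I} p = ∑-cong I λ i → trans (*-congˡ (δ-refl I i)) (*-identityʳ _)

  ·-ΣM : ∀ n (M : Mat I J) (f : ℕ → Mat J K) → M · ΣM n f ≋ ΣM n (λ a → M · f a)
  ·-ΣM zero    M f = ·-𝟘 M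
  ·-ΣM (suc n) M f = ≋-trans (·-⊕ M _ _) (⊕-cong ≋-refl (·-ΣM n M (f ∘ suc)))

  ΣM-· : ∀ n (f : ℕ → Mat I J) (M : Mat J K) → ΣM n f · M ≋ ΣM n (λ a → f a · M)
  ΣM-· zero    f M = 𝟘-· M
  ΣM-· (suc n) f M = ≋-trans (⊕-· _ _ M) (⊕-cong ≋-refl (ΣM-· n (f ∘ suc) M))

  ΣM-cong : ∀ n {f g : ℕ → Mat I J} → (∀ a → f a ≋ g a) → ΣM n f ≋ ΣM n g
  ΣM-cong zero    p = ≋-refl
  ΣM-cong (suc n) p = ⊕-cong (p 0) (ΣM-cong n (p ∘ suc))

  ΣM-zero : ∀ n {f : ℕ → Mat I J} → (∀ a → f a ≋ 𝟘) → ΣM n f ≋ 𝟘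
  ΣM-zero zero    z = ≋-refl
  ΣM-zero (suc n) z = ≋-trans (⊕-cong (z 0) (ΣM-zero n (z ∘ suc))) (⊕-𝟘 _)

  ΣM-⊕ : ∀ n (f g : ℕ → Mat I J) → ΣM n (λ a → f a ⊕ g a) ≋ ΣM n f ⊕ ΣM n g
  ΣM-⊕ zero    f g = ≋-sym (⊕-𝟘 𝟘)
  ΣM-⊕ (suc n) f g = ≋-trans (⊕-cong ≋-refl (ΣM-⊕ n (f ∘ suc) (g ∘ suc)))
    (pointwise λ _ _ → interchange _ _ _ _)

  ι-+ : ∀ m n → ι (m ℕ.+ n) ≈ ι m + ι n
  ι-+ m n = ×-homo-+ 1# m n

  -- The hypothesis is a difference `f a - f (suc a)` in additive form: `f` takes natural values and
  -- is not known to decrease when this is applied.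
  tr-telescope : ∀ (Φ : ℕ → Mat I I) (f : ℕ → ℕ) → (∀ a → tr (Φ a) + ι (f (suc a)) ≈ ι (f a)) →
                 ∀ n → tr (ΣM n Φ) + ι (f n) ≈ ι (f 0)
  tr-telescope {I} Φ f p zero    = trans (+-congʳ (∑-0 I λ _ → refl)) (+-identityˡ _)
  tr-telescope {I} Φ f p (suc n) =
    trans (+-congʳ (tr-⊕ (Φ 0) (ΣM n (Φ ∘ suc))))
    (trans (+-assoc _ _ _)
    (trans (+-congˡ (tr-telescope (Φ ∘ suc) (f ∘ suc) (p ∘ suc) n)) (p 0)))

  -- A candidate for the spectral projections of `L` at the positive integers; `E a` belongs to a +
  -- 1. Both sides are recorded because `L` is cancelled from the left as well as from the right,
  -- and the constructions below preserve exactly these equations.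
  record Eigen (L : Mat I I) (E : ℕ → Mat I I) : Set (c ⊔ ℓ) where
    field
      left  : ∀ a → L · E a ≋ ι (suc a) ⊛ E a
      right : ∀ a → E a · L ≋ ι (suc a) ⊛ E a

  open Eigen public

  ΣM-left≋right : ∀ {L : Mat I I} {E} → Eigen L E → ∀ n → L · ΣM n E ≋ ΣM n E · L
  ΣM-left≋right {L = L} {E} e n = begin
    L · ΣM n E                   ≈⟨ ·-ΣM n L E ⟩
    ΣM n (λ a → L · E a)         ≈⟨ ΣM-cong n (λ a → ≋-trans (left e a) (≋-sym (right e a))) ⟩
    ΣM n (λ a → E a · L)         ≈⟨ ΣM-· n E L ⟨
    ΣM n E · L                   ∎

  Eigen-resp : ∀ {L L′ : Mat I I} {E} → L ≋ L′ → Eigen L E → Eigen L′ E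
  Eigen-resp p e = record
    { left  = λ a → ≋-trans (·-congʳ (≋-sym p)) (left e a)
    ; right = λ a → ≋-trans (·-congˡ (≋-sym p)) (right e a)
    }

  -- Replacing H by One ⊕ H raises all eigenvalues by one, and the complement of
  -- the eigenspaces in the range of One acquires the eigenvalue 1.
  raise : ℕ → Mat I I → (ℕ → Mat I I) → ℕ → Mat I I
  raise n One Φ zero    = One ⊖ ΣM n Φ
  raise n One Φ (suc a) = Φ a

  ΣM-raise : ∀ n (One : Mat I I) Φ → ΣM (suc n) (raise n One Φ) ≋ One
  ΣM-raise n One Φ = pointwise λ i j →
    trans (+-assoc _ _ _) (trans (+-congˡ (-‿inverseˡ _)) (+-identityʳ _))

  module Invertible (inv : ℕ → Carrier) (ι-inv : ∀ a → ι (suc a) * inv a ≈ 1#) where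

    ⊛-inv : ∀ a (M : Mat I J) → inv a ⊛ ι (suc a) ⊛ M ≋ M
    ⊛-inv a M = ≋-trans (⊛-⊛ _ _ M) (≋-trans (⊛-cong (trans (*-comm _ _) (ι-inv a)) ≋-refl) (1-⊛ M))

    E≋LE : ∀ {L : Mat I I} {E} → Eigen L E → ∀ a → E a ≋ inv a ⊛ (L · E a)
    E≋LE e a = ≋-trans (≋-sym (⊛-inv a _)) (⊛-cong refl (≋-sym (left e a)))

    E≋EL : ∀ {L : Mat I I} {E} → Eigen L E → ∀ a → E a ≋ inv a ⊛ (E a · L)
    E≋EL e a = ≋-trans (≋-sym (⊛-inv a _)) (⊛-cong refl (≋-sym (right e a)))

    -- Since a + 1 is invertible, `E a` is a multiple of `L · E a`: matrices that agree after
    -- multiplication by `L` agree after multiplication by `E a`.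
    absorbˡ : ∀ {L : Mat I I} {E} {Z : Mat J I} {Z′ : Mat J I} → Eigen L E →
              Z · L ≋ Z′ · L → ∀ a → Z · E a ≋ Z′ · E a
    absorbˡ {L = L} {E} {Z} {Z′} e p a = begin
      Z · E a                   ≈⟨ ·-congˡ (E≋LE e a) ⟩
      Z · (inv a ⊛ (L · E a))   ≈⟨ ·-⊛ _ Z _ ⟩
      inv a ⊛ (Z · (L · E a))   ≈⟨ ⊛-cong refl (·-assoc Z L _) ⟨
      inv a ⊛ ((Z · L) · E a)   ≈⟨ ⊛-cong refl (·-congʳ p) ⟩
      inv a ⊛ ((Z′ · L) · E a)  ≈⟨ ⊛-cong refl (·-assoc Z′ L _) ⟩
      inv a ⊛ (Z′ · (L · E a))  ≈⟨ ·-⊛ _ Z′ _ ⟨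
      Z′ · (inv a ⊛ (L · E a))  ≈⟨ ·-congˡ (E≋LE e a) ⟨
      Z′ · E a                  ∎

    absorbʳ : ∀ {L : Mat I I} {E} {Z : Mat I J} {Z′ : Mat I J} → Eigen L E →
              L · Z ≋ L · Z′ → ∀ a → E a · Z ≋ E a · Z′
    absorbʳ {L = L} {E} {Z} {Z′} e p a = begin
      E a · Z                   ≈⟨ ·-congʳ (E≋EL e a) ⟩
      (inv a ⊛ (E a · L)) · Z   ≈⟨ ⊛-· _ _ Z ⟩
      inv a ⊛ ((E a · L) · Z)   ≈⟨ ⊛-cong refl (·-assoc _ L Z) ⟩
      inv a ⊛ (E a · (L · Z))   ≈⟨ ⊛-cong refl (·-congˡ p) ⟩
      inv a ⊛ (E a · (L · Z′))  ≈⟨ ⊛-cong refl (·-assoc _ L Z′) ⟨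
      inv a ⊛ ((E a · L) · Z′)  ≈⟨ ⊛-· _ _ Z′ ⟨
      (inv a ⊛ (E a · L)) · Z′  ≈⟨ ·-congʳ (E≋EL e a) ⟨
      E a · Z′                  ∎

    annihilateˡ : ∀ {L : Mat I I} {E} {Z : Mat J I} → Eigen L E →
                  Z · L ≋ 𝟘 → ∀ a → Z · E a ≋ 𝟘
    annihilateˡ e p a = ≋-trans (absorbˡ {Z′ = 𝟘} e (≋-trans p (≋-sym (𝟘-· _))) a) (𝟘-· _)

    annihilateʳ : ∀ {L : Mat I I} {E} {Z : Mat I J} → Eigen L E →
                  L · Z ≋ 𝟘 → ∀ a → E a · Z ≋ 𝟘
    annihilateʳ e p a = ≋-trans (absorbʳ {Z′ = 𝟘} e (≋-trans p (≋-sym (·-𝟘 _))) a) (·-𝟘 _)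

    -- V U and U V have the same non-zero eigenvalues.
    transfer : Mat I J → Mat J I → (ℕ → Mat J J) → ℕ → Mat I I
    transfer U V Ψ a = inv a ⊛ (U · Ψ a · V)

    transfer-Eigen : ∀ {U : Mat I J} {V Ψ} → Eigen (V · U) Ψ → Eigen (U · V) (transfer U V Ψ)
    transfer-Eigen {U = U} {V} {Ψ} e = record
      { left  = λ a → begin
          U · V · (inv a ⊛ (U · Ψ a · V))      ≈⟨ ·-⊛ _ _ _ ⟩
          inv a ⊛ (U · V · (U · Ψ a · V))      ≈⟨ ⊛-cong refl (shuffleˡ a) ⟩
          inv a ⊛ (U · ((V · U) · Ψ a) · V)    ≈⟨ ⊛-cong refl (·-congʳ (·-congˡ (left e a))) ⟩
          inv a ⊛ (U · (ι (suc a) ⊛ Ψ a) · V)  ≈⟨ ⊛-cong refl (pull a) ⟩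
          inv a ⊛ ι (suc a) ⊛ (U · Ψ a · V)    ≈⟨ exchange a _ ⟩
          ι (suc a) ⊛ inv a ⊛ (U · Ψ a · V)    ∎
      ; right = λ a → begin
          (inv a ⊛ (U · Ψ a · V)) · (U · V)    ≈⟨ ⊛-· _ _ _ ⟩
          inv a ⊛ (U · Ψ a · V · (U · V))      ≈⟨ ⊛-cong refl (shuffleʳ a) ⟩
          inv a ⊛ (U · (Ψ a · (V · U)) · V)    ≈⟨ ⊛-cong refl (·-congʳ (·-congˡ (right e a))) ⟩
          inv a ⊛ (U · (ι (suc a) ⊛ Ψ a) · V)  ≈⟨ ⊛-cong refl (pull a) ⟩
          inv a ⊛ ι (suc a) ⊛ (U · Ψ a · V)    ≈⟨ exchange a _ ⟩
          ι (suc a) ⊛ inv a ⊛ (U · Ψ a · V)    ∎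
      }
      where
      pull : ∀ a → U · (ι (suc a) ⊛ Ψ a) · V ≋ ι (suc a) ⊛ (U · Ψ a · V)
      pull a = ≋-trans (·-congʳ (·-⊛ _ U _)) (⊛-· _ _ V)

      exchange : ∀ a (M : Mat _ _) → inv a ⊛ ι (suc a) ⊛ M ≋ ι (suc a) ⊛ inv a ⊛ M
      exchange a M = ≋-trans (⊛-⊛ _ _ M) (≋-trans (⊛-cong (*-comm _ _) ≋-refl) (≋-sym (⊛-⊛ _ _ M)))

      shuffleˡ : ∀ a → U · V · (U · Ψ a · V) ≋ U · ((V · U) · Ψ a) · V
      shuffleˡ a = begin
        U · V · (U · Ψ a · V)     ≈⟨ ·-assoc (U · V) (U · Ψ a) V ⟨
        U · V · (U · Ψ a) · V     ≈⟨ ·-congʳ (·-assoc U V (U · Ψ a)) ⟩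
        U · (V · (U · Ψ a)) · V   ≈⟨ ·-congʳ (·-congˡ (·-assoc V U (Ψ a))) ⟨
        U · ((V · U) · Ψ a) · V   ∎

      shuffleʳ : ∀ a → U · Ψ a · V · (U · V) ≋ U · (Ψ a · (V · U)) · V
      shuffleʳ a = begin
        U · Ψ a · V · (U · V)     ≈⟨ ·-assoc (U · Ψ a · V) U V ⟨
        U · Ψ a · V · U · V       ≈⟨ ·-congʳ (·-assoc (U · Ψ a) V U) ⟩
        U · Ψ a · (V · U) · V     ≈⟨ ·-congʳ (·-assoc U (Ψ a) (V · U)) ⟩
        U · (Ψ a · (V · U)) · V   ∎

    -- Cycling `V` round the trace turns `U · Ψ a · V` into `V · U · Ψ a`, which is a + 1 times
    -- `Ψ a`; the factor `inv a` in `transfer` is there to cancel this.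
    transfer-tr : ∀ {U : Mat I J} {V Ψ} → Eigen (V · U) Ψ → ∀ a → tr (transfer U V Ψ a) ≈ tr (Ψ a)
    transfer-tr {U = U} {V} {Ψ} e a =
      trans (tr-⊛ (inv a) (U · Ψ a · V))
      (trans (*-congˡ (trans (tr-comm (U · Ψ a) V) (tr-cong (≋-sym (·-assoc V U (Ψ a))))))
      (trans (sym (tr-⊛ (inv a) (V · U · Ψ a))) (tr-cong (≋-sym (E≋LE e a)))))

    -- The eigenmatrices of `P` factor through `P` on both sides, so `Q` kills them, and conversely;
    -- the cross terms disappear.
    sum-Eigen : ∀ {P Q : Mat I I} {F G} → Eigen P F → Eigen Q G → P · Q ≋ 𝟘 → Q · P ≋ 𝟘 →
                Eigen (P ⊕ Q) (λ a → F a ⊕ G a)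
    sum-Eigen {P = P} {Q} {F} {G} f g PQ QP = record
      { left  = λ a → begin
          (P ⊕ Q) · (F a ⊕ G a)                        ≈⟨ ·-⊕ (P ⊕ Q) _ _ ⟩
          (P ⊕ Q) · F a ⊕ (P ⊕ Q) · G a                ≈⟨ ⊕-cong (⊕-· P Q _) (⊕-· P Q _) ⟩
          (P · F a ⊕ Q · F a) ⊕ (P · G a ⊕ Q · G a)    ≈⟨ ⊕-cong
                                                          (⊕-cong (left f a) (annihilateˡ f QP a))
                                                          (⊕-cong (annihilateˡ g PQ a) (left g a)) ⟩
          (ι (suc a) ⊛ F a ⊕ 𝟘) ⊕ (𝟘 ⊕ ι (suc a) ⊛ G a)  ≈⟨ collect a ⟩
          ι (suc a) ⊛ (F a ⊕ G a)                      ∎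
      ; right = λ a → begin
          (F a ⊕ G a) · (P ⊕ Q)                        ≈⟨ ⊕-· _ _ (P ⊕ Q) ⟩
          F a · (P ⊕ Q) ⊕ G a · (P ⊕ Q)                ≈⟨ ⊕-cong (·-⊕ _ P Q) (·-⊕ _ P Q) ⟩
          (F a · P ⊕ F a · Q) ⊕ (G a · P ⊕ G a · Q)    ≈⟨ ⊕-cong
                                                          (⊕-cong (right f a) (annihilateʳ f PQ a))
                                                          (⊕-cong (annihilateʳ g QP a) (right g a)) ⟩
          (ι (suc a) ⊛ F a ⊕ 𝟘) ⊕ (𝟘 ⊕ ι (suc a) ⊛ G a)  ≈⟨ collect a ⟩
          ι (suc a) ⊛ (F a ⊕ G a)                      ∎
      }
      where
      collect : ∀ a → (ι (suc a) ⊛ F a ⊕ 𝟘) ⊕ (𝟘 ⊕ ι (suc a) ⊛ G a) ≋ ι (suc a) ⊛ (F a ⊕ G a)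
      collect a = ≋-trans (⊕-cong (⊕-𝟘 _) (𝟘-⊕ _)) (≋-sym (⊛-⊕ _ _ _))

    -- `H · ΣM n Φ ≋ H` says that the family exhausts the range of `H`. Hence `H` kills
    -- `One ⊖ ΣM n Φ`, which keeps the eigenvalue 1 of `One`, while on each `Φ a` the idempotent
    -- `One` acts as the identity and adds 1.
    raise-Eigen : ∀ {H One : Mat I I} {Φ} n → Eigen H Φ →
                  One · One ≋ One → One · H ≋ H → H · One ≋ H → H · ΣM n Φ ≋ H →
                  Eigen (One ⊕ H) (raise n One Φ)
    raise-Eigen {H = H} {One} {Φ} n e OO OH HO HΣ = record { left = l ; right = r }
      where
      One-Φ : ∀ a → One · Φ a ≋ Φ a
      One-Φ a = ≋-trans (absorbˡ {Z′ = 𝟙} e (≋-trans OH (≋-sym (𝟙-· H))) a) (𝟙-· _)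

      Φ-One : ∀ a → Φ a · One ≋ Φ a
      Φ-One a = ≋-trans (absorbʳ {Z′ = 𝟙} e (≋-trans HO (≋-sym (·-𝟙 H))) a) (·-𝟙 _)

      Φ₀ = One ⊖ ΣM n Φ

      tidy₀ : {Φ₀ : Mat _ _} → Φ₀ ⊕ 𝟘 ≋ ι 1 ⊛ Φ₀
      tidy₀ = ≋-trans (⊕-𝟘 _) (≋-trans (≋-sym (1-⊛ _)) (⊛-cong (sym (+-identityʳ 1#)) ≋-refl))

      tidy₊ : ∀ a {M : Mat _ _} → M ⊕ ι (suc a) ⊛ M ≋ ι (suc (suc a)) ⊛ M
      tidy₊ a = ≋-trans (⊕-cong (≋-sym (1-⊛ _)) ≋-refl) (≋-sym (+-⊛ _ _ _))

      l : ∀ a → (One ⊕ H) · raise n One Φ a ≋ ι (suc a) ⊛ raise n One Φ a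
      l zero = begin
        (One ⊕ H) · Φ₀           ≈⟨ ⊕-· One H Φ₀ ⟩
        One · Φ₀ ⊕ H · Φ₀        ≈⟨ ⊕-cong
          (≋-trans (·-⊖ One One _) (⊖-cong OO (≋-trans (·-ΣM n One Φ) (ΣM-cong n One-Φ))))
          (≋-trans (·-⊖ H One _) (≋-trans (⊖-cong HO HΣ) (⊖-self H))) ⟩
        Φ₀ ⊕ 𝟘                   ≈⟨ tidy₀ ⟩
        ι 1 ⊛ Φ₀                 ∎
      l (suc a) = begin
        (One ⊕ H) · Φ a          ≈⟨ ⊕-· One H _ ⟩
        One · Φ a ⊕ H · Φ a      ≈⟨ ⊕-cong (One-Φ a) (left e a) ⟩
        Φ a ⊕ ι (suc a) ⊛ Φ a    ≈⟨ tidy₊ a ⟩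
        ι (suc (suc a)) ⊛ Φ a    ∎

      ΣH : ΣM n Φ · H ≋ H
      ΣH = ≋-trans (≋-sym (ΣM-left≋right e n)) HΣ

      r : ∀ a → raise n One Φ a · (One ⊕ H) ≋ ι (suc a) ⊛ raise n One Φ a
      r zero = begin
        Φ₀ · (One ⊕ H)           ≈⟨ ·-⊕ Φ₀ One H ⟩
        Φ₀ · One ⊕ Φ₀ · H        ≈⟨ ⊕-cong
          (≋-trans (⊖-· One _ One) (⊖-cong OO (≋-trans (ΣM-· n Φ One) (ΣM-cong n Φ-One))))
          (≋-trans (⊖-· One _ H) (≋-trans (⊖-cong OH ΣH) (⊖-self H))) ⟩
        Φ₀ ⊕ 𝟘                   ≈⟨ tidy₀ ⟩
        ι 1 ⊛ Φ₀                 ∎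
      r (suc a) = begin
        Φ a · (One ⊕ H)          ≈⟨ ·-⊕ _ One H ⟩
        Φ a · One ⊕ Φ a · H      ≈⟨ ⊕-cong (Φ-One a) (right e a) ⟩
        Φ a ⊕ ι (suc a) ⊛ Φ a    ≈⟨ tidy₊ a ⟩
        ι (suc (suc a)) ⊛ Φ a    ∎

    -- Each term `V · transfer U V Ψ a` contains `V · U · Ψ a`, whose factor a + 1 cancels `inv a`.
    -- This moves completeness from the family of `V · U` to that of `U · V`.
    transfer-intertwines : ∀ {U : Mat I J} {V Ψ} → Eigen (V · U) Ψ →
                           ∀ n → V · ΣM n (transfer U V Ψ) ≋ ΣM n Ψ · V
    transfer-intertwines {U = U} {V} {Ψ} e n = begin
      V · ΣM n (transfer U V Ψ)              ≈⟨ ·-ΣM n V _ ⟩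
      ΣM n (λ a → V · transfer U V Ψ a)      ≈⟨ ΣM-cong n one ⟩
      ΣM n (λ a → Ψ a · V)                   ≈⟨ ΣM-· n Ψ V ⟨
      ΣM n Ψ · V                             ∎
      where
      one : ∀ a → V · transfer U V Ψ a ≋ Ψ a · V
      one a = begin
        V · (inv a ⊛ (U · Ψ a · V))       ≈⟨ ·-⊛ _ V _ ⟩
        inv a ⊛ (V · (U · Ψ a · V))       ≈⟨ ⊛-cong refl (·-assoc V (U · Ψ a) V) ⟨
        inv a ⊛ (V · (U · Ψ a) · V)       ≈⟨ ⊛-cong refl (·-congʳ (·-assoc V U (Ψ a))) ⟨
        inv a ⊛ (V · U · Ψ a · V)         ≈⟨ ⊛-· _ (V · U · Ψ a) V ⟨
        (inv a ⊛ (V · U · Ψ a)) · V       ≈⟨ ·-congʳ (E≋LE e a) ⟨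
        Ψ a · V                           ∎

    -- The index sets keep apart what differs in size: `K`, `J` and `N` stand for sets without the
    -- vertex 0 that have one element more than, as many as, and one element fewer than the row sets
    -- `T` of `D`. In the application `sub n` serves for these three and `sub (suc n)` for `S` and
    -- `T`.
    record Step {J K N S T : Index} : Set (lsuc (c ⊔ ℓ)) where
      field
        D   : Mat T S
        A   : Mat J K
        B   : Mat N J
        One : Mat J J
        X   : Mat S J
        Y   : Mat T J
        D≋  : D ≋ Y · X ᵀ
        YY  : Y ᵀ · Y ≋ One ⊕ B ᵀ · B
        XX  : X ᵀ · X ≋ One ⊕ A · A ᵀ
        1A  : One · A ≋ A
        B1  : B · One ≋ B
        BA  : B · A ≋ 𝟘
        1-1 : One · One ≋ One
        1ᵀ  : One ᵀ ≋ One
        1X  : One · X ᵀ ≋ X ᵀ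

      module _ {F₀ : ℕ → Mat K K} {G : ℕ → Mat J J} (n : ℕ)
               (f₀ : Eigen (A ᵀ · A) F₀) (g : Eigen (B ᵀ · B) G)
               (AΣ : A · ΣM n F₀ ≋ A) (BΣ : B · ΣM n G ≋ B)
               where

        F Φ : ℕ → Mat J J
        F   = transfer A (A ᵀ) F₀
        Φ a = F a ⊕ G a

        E : ℕ → Mat S S
        E = transfer (X · (Y ᵀ · Y)) (X ᵀ) (raise n One Φ)

        private
          AA BB H : Mat J J
          AA = A · A ᵀ
          BB = B ᵀ · B
          H  = AA ⊕ BB

          1AA : One · AA ≋ AA
          1AA = ≋-trans (≋-sym (·-assoc One A (A ᵀ))) (·-congʳ 1A)

          AA1 : AA · One ≋ AA
          AA1 = begin
            A · A ᵀ · One          ≈⟨ ·-assoc A (A ᵀ) One ⟩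
            A · (A ᵀ · One)        ≈⟨ ·-congˡ (·-congˡ (≋-sym 1ᵀ)) ⟩
            A · (A ᵀ · One ᵀ)      ≈⟨ ·-congˡ (ᵀ-· One A) ⟨
            A · (One · A) ᵀ        ≈⟨ ·-congˡ (ᵀ-cong 1A) ⟩
            A · A ᵀ                ∎

          BB1 : BB · One ≋ BB
          BB1 = ≋-trans (·-assoc (B ᵀ) B One) (·-congˡ B1)

          1BB : One · BB ≋ BB
          1BB = begin
            One · (B ᵀ · B)        ≈⟨ ·-assoc One (B ᵀ) B ⟨
            One · B ᵀ · B          ≈⟨ ·-congʳ (·-congʳ (≋-sym 1ᵀ)) ⟩
            One ᵀ · B ᵀ · B        ≈⟨ ·-congʳ (ᵀ-· B One) ⟨
            (B · One) ᵀ · B        ≈⟨ ·-congʳ (ᵀ-cong B1) ⟩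
            B ᵀ · B                ∎

          BBAA : BB · AA ≋ 𝟘
          BBAA = begin
            B ᵀ · B · (A · A ᵀ)    ≈⟨ ·-assoc (B ᵀ · B) A (A ᵀ) ⟨
            B ᵀ · B · A · A ᵀ      ≈⟨ ·-congʳ (·-assoc (B ᵀ) B A) ⟩
            B ᵀ · (B · A) · A ᵀ    ≈⟨ ·-congʳ (·-congˡ BA) ⟩
            B ᵀ · 𝟘 · A ᵀ          ≈⟨ ·-congʳ (·-𝟘 (B ᵀ)) ⟩
            𝟘 · A ᵀ                ≈⟨ 𝟘-· (A ᵀ) ⟩
            𝟘                      ∎

          AABB : AA · BB ≋ 𝟘
          AABB = begin
            AA · BB                ≈⟨ ·-cong (ᵀ-· A (A ᵀ)) (ᵀ-· (B ᵀ) B) ⟨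
            AA ᵀ · BB ᵀ            ≈⟨ ᵀ-· BB AA ⟨
            (BB · AA) ᵀ            ≈⟨ ᵀ-cong BBAA ⟩
            𝟘                      ∎

          φ : Eigen H Φ
          φ = sum-Eigen (transfer-Eigen f₀) g AABB BBAA

          AAΣF : AA · ΣM n F ≋ AA
          AAΣF = begin
            A · A ᵀ · ΣM n F       ≈⟨ ·-assoc A (A ᵀ) _ ⟩
            A · (A ᵀ · ΣM n F)     ≈⟨ ·-congˡ (transfer-intertwines f₀ n) ⟩
            A · (ΣM n F₀ · A ᵀ)    ≈⟨ ·-assoc A _ (A ᵀ) ⟨
            A · ΣM n F₀ · A ᵀ      ≈⟨ ·-congʳ AΣ ⟩
            A · A ᵀ                ∎

          BBΣG : BB · ΣM n G ≋ BB
          BBΣG = ≋-trans (·-assoc (B ᵀ) B _) (·-congˡ BΣ)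

          kill : ∀ {P : Mat J J} {Q : ℕ → Mat J J} → (∀ a → P · Q a ≋ 𝟘) → P · ΣM n Q ≋ 𝟘
          kill {P} {Q} p = ≋-trans (·-ΣM n P Q) (ΣM-zero n p)

          HΣ : H · ΣM n Φ ≋ H
          HΣ = begin
            H · ΣM n Φ                                        ≈⟨ ·-congˡ (ΣM-⊕ n F G) ⟩
            H · (ΣM n F ⊕ ΣM n G)                             ≈⟨ ⊕-· AA BB _ ⟩
            AA · (ΣM n F ⊕ ΣM n G) ⊕ BB · (ΣM n F ⊕ ΣM n G)   ≈⟨ ⊕-cong (·-⊕ AA _ _) (·-⊕ BB _ _) ⟩
            (AA · ΣM n F ⊕ AA · ΣM n G) ⊕ (BB · ΣM n F ⊕ BB · ΣM n G)
              ≈⟨ ⊕-cong (⊕-cong AAΣF (kill (annihilateˡ g AABB)))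
                        (⊕-cong (kill (annihilateˡ (transfer-Eigen f₀) BBAA)) BBΣG) ⟩
            (AA ⊕ 𝟘) ⊕ (𝟘 ⊕ BB)                               ≈⟨ ⊕-cong (⊕-𝟘 AA) (𝟘-⊕ BB) ⟩
            H                                                 ∎

          ψ : Eigen (One ⊕ H) (raise n One Φ)
          ψ = raise-Eigen n φ 1-1
                (≋-trans (·-⊕ One AA BB) (⊕-cong 1AA 1BB))
                (≋-trans (⊕-· AA BB One) (⊕-cong AA1 BB1)) HΣ

          XXW : X ᵀ · (X · (Y ᵀ · Y)) ≋ One ⊕ H
          XXW = begin
            X ᵀ · (X · (Y ᵀ · Y))                    ≈⟨ ·-assoc (X ᵀ) X _ ⟨
            X ᵀ · X · (Y ᵀ · Y)                      ≈⟨ ·-cong XX YY ⟩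
            (One ⊕ AA) · (One ⊕ BB)                  ≈⟨ ·-⊕ (One ⊕ AA) One BB ⟩
            (One ⊕ AA) · One ⊕ (One ⊕ AA) · BB       ≈⟨ ⊕-cong (⊕-· One AA One) (⊕-· One AA BB) ⟩
            (One · One ⊕ AA · One) ⊕ (One · BB ⊕ AA · BB)
              ≈⟨ ⊕-cong (⊕-cong 1-1 AA1) (⊕-cong 1BB AABB) ⟩
            (One ⊕ AA) ⊕ (BB ⊕ 𝟘)                    ≈⟨ ⊕-cong ≋-refl (⊕-𝟘 BB) ⟩
            (One ⊕ AA) ⊕ BB                          ≈⟨ pointwise (λ _ _ → +-assoc _ _ _) ⟩
            One ⊕ H                                  ∎

          ψ′ : Eigen (X ᵀ · (X · (Y ᵀ · Y))) (raise n One Φ)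
          ψ′ = Eigen-resp (≋-sym XXW) ψ

          DD : X · (Y ᵀ · Y) · X ᵀ ≋ D ᵀ · D
          DD = begin
            X · (Y ᵀ · Y) · X ᵀ       ≈⟨ ·-congʳ (·-assoc X (Y ᵀ) Y) ⟨
            X · Y ᵀ · Y · X ᵀ         ≈⟨ ·-assoc (X · Y ᵀ) Y (X ᵀ) ⟩
            X · Y ᵀ · (Y · X ᵀ)       ≈⟨ ·-congʳ (ᵀ-· Y (X ᵀ)) ⟨
            (Y · X ᵀ) ᵀ · (Y · X ᵀ)   ≈⟨ ·-cong (ᵀ-cong D≋) D≋ ⟨
            D ᵀ · D                   ∎

        step-Eigen : Eigen (D ᵀ · D) E
        step-Eigen = Eigen-resp DD (transfer-Eigen ψ′)

        -- By construction the raised family sums to `One`, which acts as the identity on `X ᵀ`;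
        -- intertwining along `X ᵀ` hands this on to `D`. The bound on the eigenvalues grows by one
        -- because of the raise.
        step-complete : D · ΣM (suc n) E ≋ D
        step-complete = begin
          D · ΣM (suc n) E                        ≈⟨ ·-congʳ D≋ ⟩
          Y · X ᵀ · ΣM (suc n) E                  ≈⟨ ·-assoc Y (X ᵀ) _ ⟩
          Y · (X ᵀ · ΣM (suc n) E)                ≈⟨ ·-congˡ (transfer-intertwines ψ′ (suc n)) ⟩
          Y · (ΣM (suc n) (raise n One Φ) · X ᵀ)  ≈⟨ ·-congˡ (·-congʳ (ΣM-raise n One Φ)) ⟩
          Y · (One · X ᵀ)                         ≈⟨ ·-congˡ 1X ⟩
          Y · X ᵀ                                 ≈⟨ D≋ ⟨
          D                                       ∎

        module _ (d e : ℕ → ℕ) {d₀ : ℕ} (d-F : ∀ a → tr (F₀ a) + ι (d (suc a)) ≈ ι (d a))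
                 (e-G : ∀ a → tr (G a) + ι (e (suc a)) ≈ ι (e a))
                 (d-n : d n ≡ 0) (e-n : e n ≡ 0) (tr-One : tr One ≈ ι d₀)
                 where

          private
            φ-tr : ∀ a → tr (Φ a) + ι (d (suc a) ℕ.+ e (suc a)) ≈ ι (d a ℕ.+ e a)
            φ-tr a = trans
              (+-cong (trans (tr-⊕ (F a) (G a)) (+-congʳ (transfer-tr f₀ a))) (ι-+ (d (suc a)) (e (suc a))))
              (trans (interchange _ _ _ _) (trans (+-cong (d-F a) (e-G a)) (sym (ι-+ (d a) (e a)))))

            Σφ-tr : tr (ΣM n Φ) ≈ ι (d 0 ℕ.+ e 0)
            Σφ-tr = trans (sym (+-identityʳ _))
              (trans (+-congˡ (reflexive (≡.cong ι (≡.sym (≡.cong₂ ℕ._+_ d-n e-n)))))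
                     (tr-telescope Φ (λ a → d a ℕ.+ e a) φ-tr n))

          -- The eigenvalue 1 receives the trace of `One` less that of all of `Φ`; the latter
          -- telescopes to `d 0 + e 0` because both sequences have reached 0 at n. All other traces
          -- move up by one index, just as `◂` moves the degrees.
          step-tr : ∀ a → tr (E a) + ι (d a ℕ.+ e a) ≈ ι ((d₀ ◂ (λ b → d b ℕ.+ e b)) a)
          step-tr zero =
            trans (+-cong (transfer-tr ψ′ 0) (sym Σφ-tr))
            (trans (sym (tr-⊕ (One ⊖ ΣM n Φ) (ΣM n Φ)))
            (trans (tr-cong (ΣM-raise n One Φ)) tr-One))
          step-tr (suc a) = trans (+-congʳ (transfer-tr ψ′ (suc a))) (φ-tr a)

-- Single replacements, deletion and contraction.

infix 4 _◃_ _⊴_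

-- The covering relation of the lattice of subsets, arranged for recursion on the smallest vertex.
data _◃_ : ∀ {n} → Subset n → Subset n → Set where
  here  : ∀ {n} {F : Subset n} → outside ∷ F ◃ inside ∷ F
  there : ∀ {n b} {G F : Subset n} → G ◃ F → b ∷ G ◃ b ∷ F

-- F ⊴ G: one element of G is replaced by a smaller one.
data _⊴_ : ∀ {n} → Subset n → Subset n → Set where
  swap : ∀ {n} {G F : Subset n} → G ◃ F → inside ∷ G ⊴ outside ∷ F
  keep : ∀ {n b} {F G : Subset n} → F ⊴ G → b ∷ F ⊴ b ∷ G

-- The combinatorial form of shiftedness that the recursion uses: it speaks of positions only, and
-- `keep` passes it on to deletion and contraction.
Closed : ∀ {n} → (Subset n → Bool) → Set
Closed K = ∀ {F G} → F ⊴ G → T (K G) → T (K F)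

count : ∀ {a} {A : Set a} → (A → Bool) → List A → ℕ
count p xs = length (filterᵇ p xs)

-- Deletion and contraction of the vertex 0.
del con : ∀ {n} → (Subset (suc n) → Bool) → Subset n → Bool
del K = K ∘ (outside ∷_)
con K = K ∘ (inside ∷_)

-- The degree of the vertex b of a closed pair, by recursion along del and con; 0 for b ≥ n.
deg : ∀ n (K K′ : Subset n → Bool) → ℕ → ℕ
deg zero    K K′ _ = 0
deg (suc n) K K′   =
  count (λ G → con K G ∧ not (del K′ G)) (subsets n) ◂
  λ b → deg n (del K) (del K′) b ℕ.+ deg n (con K) (con K′) b

deg-vanish : ∀ n K K′ {b} → n ℕ.≤ b → deg n K K′ b ≡ 0
deg-vanish zero    K K′ _           = ≡.refl
deg-vanish (suc n) K K′ (ℕ.s≤s n≤b) =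
  ≡.cong₂ ℕ._+_ (deg-vanish n (del K) (del K′) n≤b) (deg-vanish n (con K) (con K′) n≤b)

-- Boundary matrices on the set of all subsets.

module BoundaryMatrices {c ℓ} (R : CommutativeRing c ℓ) where
  open Matrices R
  open CommutativeRing R
  open RingProperties ring using (-‿distribˡ-*; -‿distribʳ-*; -0#≈0#; -‿involutive)
  open SemiringSum semiring using (sum; sum-cong-≋)
  open Index

  [_] : Bool → Carrier
  [ b ] = if b then 1# else 0#

  listSum : ∀ {a} {A : Set a} → List A → (A → Carrier) → Carrier
  listSum []       f = 0#
  listSum (x ∷ xs) f = f x + listSum xs f

  module _ {a} {A : Set a} where

    sum-lookup : ∀ (xs : List A) f → sum (λ i → f (lookup xs i)) ≈ listSum xs f
    sum-lookup []       f = refl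
    sum-lookup (x ∷ xs) f = +-congˡ (sum-lookup xs f)

    listSum-++ : ∀ (xs ys : List A) f → listSum (xs ++ ys) f ≈ listSum xs f + listSum ys f
    listSum-++ []       ys f = sym (+-identityˡ _)
    listSum-++ (x ∷ xs) ys f = trans (+-congˡ (listSum-++ xs ys f)) (sym (+-assoc _ _ _))

    listSum-map : ∀ {b} {B : Set b} (g : B → A) xs f → listSum (map g xs) f ≈ listSum xs (f ∘ g)
    listSum-map g []       f = refl
    listSum-map g (x ∷ xs) f = +-congˡ (listSum-map g xs f)

    listSum-filter : ∀ (p : A → Bool) xs f →
                     listSum (filterᵇ p xs) f ≈ listSum xs (λ x → [ p x ] * f x)
    listSum-filter p []       f = refl
    listSum-filter p (x ∷ xs) f with p x
    ... | true  = +-cong (sym (*-identityˡ _)) (listSum-filter p xs f)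
    ... | false = trans (listSum-filter p xs f) (sym (trans (+-congʳ (zeroˡ _)) (+-identityˡ _)))

    listSum-count : ∀ (p : A → Bool) xs → listSum xs (λ x → [ p x ]) ≈ ι (count p xs)
    listSum-count p []       = refl
    listSum-count p (x ∷ xs) with p x
    ... | true  = +-congˡ (listSum-count p xs)
    ... | false = trans (+-identityˡ _) (listSum-count p xs)

  sum-subsets : ∀ {n} (f : Subset (suc n) → Carrier) →
    sum (λ i → f (lookup (subsets (suc n)) i)) ≈
    sum (λ i → f (outside ∷ lookup (subsets n) i)) + sum (λ i → f (inside ∷ lookup (subsets n) i))
  sum-subsets {n} f =
    trans (sum-lookup (subsets (suc n)) f)
    (trans (listSum-++ (map (outside ∷_) (subsets n)) _ f)
    (+-cong (trans (listSum-map (outside ∷_) (subsets n) f) (sym (sum-lookup (subsets n) (f ∘ (outside ∷_)))))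
            (trans (listSum-map (inside ∷_) (subsets n) f) (sym (sum-lookup (subsets n) (f ∘ (inside ∷_)))))))

  equal : ∀ {n} → Subset n → Subset n → Carrier
  equal []            []            = 1#
  equal (outside ∷ F) (outside ∷ G) = equal F G
  equal (outside ∷ F) (inside  ∷ G) = 0#
  equal (inside  ∷ F) (outside ∷ G) = 0#
  equal (inside  ∷ F) (inside  ∷ G) = equal F G

  equal-refl : ∀ {n} (F : Subset n) → equal F F ≈ 1#
  equal-refl []            = refl
  equal-refl (outside ∷ F) = equal-refl F
  equal-refl (inside  ∷ F) = equal-refl F

  equal-sym : ∀ {n} (F G : Subset n) → equal F G ≈ equal G F
  equal-sym []            []            = refl
  equal-sym (outside ∷ F) (outside ∷ G) = equal-sym F G
  equal-sym (outside ∷ F) (inside  ∷ G) = refl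
  equal-sym (inside  ∷ F) (outside ∷ G) = refl
  equal-sym (inside  ∷ F) (inside  ∷ G) = equal-sym F G

  -- Vanishing of a ring element cannot be tested, so the support is given as an alternative on
  -- which proofs can split.
  equal-support : ∀ {n} (F G : Subset n) → equal F G ≈ 0# ⊎ F ≡ G
  equal-support []            []            = inj₂ ≡.refl
  equal-support (outside ∷ F) (inside  ∷ G) = inj₁ refl
  equal-support (inside  ∷ F) (outside ∷ G) = inj₁ refl
  equal-support (outside ∷ F) (outside ∷ G) with equal-support F G
  ... | inj₁ z      = inj₁ z
  ... | inj₂ ≡.refl = inj₂ ≡.refl
  equal-support (inside  ∷ F) (inside  ∷ G) with equal-support F G
  ... | inj₁ z      = inj₁ z
  ... | inj₂ ≡.refl = inj₂ ≡.refl

  sum-zero : ∀ {n} {f : Fin n → Carrier} → (∀ i → f i ≈ 0#) → sum f ≈ 0#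
  sum-zero {n} p = trans (sum-cong-≋ p) (SemiringSum.sum-replicate-zero semiring n)

  sum-equal : ∀ {n} (F : Subset n) (f : Subset n → Carrier) →
              sum (λ i → equal F (lookup (subsets n) i) * f (lookup (subsets n) i)) ≈ f F
  sum-equal []            f = trans (+-identityʳ _) (*-identityˡ _)
  sum-equal {suc n} (outside ∷ F) f =
    trans (sum-subsets (λ G → equal (outside ∷ F) G * f G))
    (trans (+-cong (sum-equal F (f ∘ (outside ∷_)))
                   (sum-zero {f = λ i → 0# * f (inside ∷ lookup (subsets n) i)} λ _ → zeroˡ _))
           (+-identityʳ _))
  sum-equal {suc n} (inside ∷ F) f =
    trans (sum-subsets (λ G → equal (inside ∷ F) G * f G))
    (trans (+-cong (sum-zero {f = λ i → 0# * f (outside ∷ lookup (subsets n) i)} λ _ → zeroˡ _)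
                   (sum-equal F (f ∘ (inside ∷_))))
           (+-identityˡ _))

  sub : ℕ → Index
  sub n = record
    { El     = Subset n
    ; enum   = lookup (subsets n)
    ; δ      = equal
    ; δ-refl = equal-refl
    ; δ-sym  = equal-sym
    ; sum-δ  = sum-equal
    }

  ∑-sub : ∀ {n} (f : Subset (suc n) → Carrier) →
          ∑ (sub (suc n)) f ≈ ∑ (sub n) (f ∘ (outside ∷_)) + ∑ (sub n) (f ∘ (inside ∷_))
  ∑-sub {n} f =
    trans (∑-sum (sub (suc n)) f) (trans (sum-subsets f)
      (sym (+-cong (∑-sum (sub n) _) (∑-sum (sub n) _))))

  -- The signed incidence numbers by recursion on the smallest vertex: removing 0 has sign 1, and a
  -- vertex 0 that stays lies below the removed one and reverses the sign.
  ∂ : ∀ {n} → Subset n → Subset n → Carrier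
  ∂ []            []            = 0#
  ∂ (outside ∷ G) (outside ∷ F) = ∂ G F
  ∂ (outside ∷ G) (inside  ∷ F) = equal G F
  ∂ (inside  ∷ G) (outside ∷ F) = 0#
  ∂ (inside  ∷ G) (inside  ∷ F) = - ∂ G F

  ∂-support : ∀ {n} (G F : Subset n) → ∂ G F ≈ 0# ⊎ G ◃ F
  ∂-support []            []            = inj₁ refl
  ∂-support (outside ∷ G) (outside ∷ F) with ∂-support G F
  ... | inj₁ z = inj₁ z
  ... | inj₂ s = inj₂ (there s)
  ∂-support (outside ∷ G) (inside  ∷ F) with equal-support G F
  ... | inj₁ z      = inj₁ z
  ... | inj₂ ≡.refl = inj₂ here
  ∂-support (inside  ∷ G) (outside ∷ F) = inj₁ refl
  ∂-support (inside  ∷ G) (inside  ∷ F) with ∂-support G F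
  ... | inj₁ z = inj₁ (trans (-‿cong z) -0#≈0#)
  ... | inj₂ s = inj₂ (there s)

  private
    -x*-y : ∀ x y → - x * - y ≈ x * y
    -x*-y x y = trans (sym (-‿distribˡ-* x (- y)))
      (trans (-‿cong (sym (-‿distribʳ-* x y))) (-‿involutive _))

    ∑-neg : ∀ I (f : El I → Carrier) → ∑ I (λ i → - f i) ≈ - ∑ I f
    ∑-neg I f = trans (∑-cong I λ i → trans (-‿cong (sym (*-identityˡ _))) (-‿distribˡ-* 1# (f i)))
      (trans (∑-*ˡ I (- 1#) f) (trans (sym (-‿distribˡ-* 1# _)) (-‿cong (*-identityˡ _))))

  -- Only the case where `F` contains 0 and `G` does not involves a cancellation: removing 0 first
  -- contributes `∂ G F`, removing it last contributes `- ∂ G F`. The other cases recur or have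
  -- vanishing terms.
  ∂∂≈0 : ∀ {n} (G F : Subset n) → ∑ (sub n) (λ H → ∂ G H * ∂ H F) ≈ 0#
  ∂∂≈0 [] [] = ∑-0 (sub 0) λ { [] → zeroˡ _ }
  ∂∂≈0 {suc n} (outside ∷ G) (outside ∷ F) =
    trans (∑-sub _) (trans (+-cong (∂∂≈0 G F) (∑-0 (sub n) λ _ → zeroʳ _)) (+-identityˡ _))
  ∂∂≈0 {suc n} (outside ∷ G) (inside ∷ F) =
    trans (∑-sub _) (trans (+-cong (trans (∑-cong (sub n) λ H → trans (*-congˡ (equal-sym H F)) (*-comm _ _))
                                          (∑-δ (sub n) F (∂ G)))
                                   (trans (∑-δ (sub n) G (λ H → - ∂ H F)) refl))
                           (-‿inverseʳ _))
  ∂∂≈0 {suc n} (inside ∷ G) (outside ∷ F) =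
    trans (∑-sub _) (trans (+-cong (∑-0 (sub n) λ _ → zeroˡ _) (∑-0 (sub n) λ _ → zeroʳ _)) (+-identityˡ _))
  ∂∂≈0 {suc n} (inside ∷ G) (inside ∷ F) =
    trans (∑-sub _) (trans (+-cong (∑-0 (sub n) λ _ → zeroˡ _)
                                   (trans (∑-cong (sub n) λ H → -x*-y _ _) (∂∂≈0 G F)))
                           (+-identityˡ _))

  -- The boundary matrix of (K , K′), extended by zero to all subsets; cardinalities
  -- play no role, so K and K′ need not be uniform.
  ∂M : ∀ {n} → (Subset n → Bool) → (Subset n → Bool) → Mat (sub n) (sub n)
  ∂M K K′ = mat λ G F → [ not (K′ G) ] * ∂ G F * [ K F ]

  private
    [T] : ∀ {b} → T b → [ b ] ≈ 1#
    [T] {true} _ = refl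

    T-not : ∀ {b} → ¬ T b → T (not b)
    T-not {true}  f = f tt
    T-not {false} _ = tt

    [F] : ∀ {b} → ¬ T b → [ b ] ≈ 0#
    [F] {true}  f = contradiction tt f
    [F] {false} _ = refl

    not-T : ∀ {b} → T (not b) → ¬ T b
    not-T {false} _ ()

  ∂M-support : ∀ {n} (K K′ : Subset n → Bool) G F →
               at (∂M K K′) G F ≈ 0# ⊎ (T (not (K′ G)) × G ◃ F × T (K F))
  ∂M-support K K′ G F with not (K′ G) | K F | ∂-support G F
  ... | false | _     | _      = inj₁ (trans (*-congʳ (zeroˡ _)) (zeroˡ _))
  ... | true  | false | _      = inj₁ (zeroʳ _)
  ... | true  | true  | inj₁ z = inj₁ (trans (*-identityʳ _) (trans (*-identityˡ _) z))
  ... | true  | true  | inj₂ s = inj₂ (tt , s , tt)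

  ∂M-unmasked : ∀ {n} (K K′ : Subset n → Bool) {G F} → T (not (K′ G)) → T (K F) →
                at (∂M K K′) G F ≈ ∂ G F
  ∂M-unmasked K K′ G∉ F∈ =
    trans (*-cong (trans (*-congʳ ([T] G∉)) (*-identityˡ _)) ([T] F∈)) (*-identityʳ _)

  -- The factorisation of the boundary matrix at the vertex 0.

  module Split {n} (K K′ : Subset (suc n) → Bool) (K↓ : Closed K) (K′↓ : Closed K′) where

    m : Subset n → Bool
    m G = con K G ∧ not (del K′ G)

    A B One : Mat (sub n) (sub n)
    A   = ∂M (del K) (del K′)
    B   = ∂M (con K) (con K′)
    One = diag ([_] ∘ m)

    X Y : Mat (sub (suc n)) (sub n)
    X = mat λ { (outside ∷ F) G → at A G F   ; (inside ∷ F) G → at One F G }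
    Y = mat λ { (outside ∷ G) H → at One G H ; (inside ∷ G) H → - at B G H }

    -- Exchanging for 0 the vertex by which `F` exceeds `G` turns `F` into `G` with 0 added, which
    -- therefore lies in `K`.
    mask-A : ∀ {G F} → T (not (del K′ G)) → G ◃ F → T (del K F) → T (m G)
    mask-A G∉ s F∈ = Equivalence.from T-∧ (K↓ (swap s) F∈ , G∉)

    -- The same exchange, applied to `K′` and read contrapositively: were `F` in `K′`, then so would
    -- be `G` with 0 added.
    mask-B : ∀ {G F} → T (not (con K′ G)) → G ◃ F → T (con K F) → T (m F)
    mask-B G∉ s F∈ = Equivalence.from T-∧ (F∈ , T-not (λ F∈′ → not-T G∉ (K′↓ (swap s) F∈′)))

    1A : One · A ≋ A
    1A = ≋-trans (diag-· ([_] ∘ m) A) (pointwise λ G F → go G F)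
      where
      go : ∀ G F → [ m G ] * at A G F ≈ at A G F
      go G F with ∂M-support (del K) (del K′) G F
      ... | inj₁ z              = trans (*-congˡ z) (trans (zeroʳ _) (sym z))
      ... | inj₂ (G∉ , s , F∈) = trans (*-congʳ ([T] (mask-A G∉ s F∈))) (*-identityˡ _)

    B1 : B · One ≋ B
    B1 = ≋-trans (·-diag ([_] ∘ m) B) (pointwise λ G F → go G F)
      where
      go : ∀ G F → at B G F * [ m F ] ≈ at B G F
      go G F with ∂M-support (con K) (con K′) G F
      ... | inj₁ z              = trans (*-congʳ z) (trans (zeroˡ _) (sym z))
      ... | inj₂ (G∉ , s , F∈) = trans (*-congˡ ([T] (mask-B G∉ s F∈))) (*-identityʳ _)

    -- Along `G ◃ H ◃ F` the conditions on the middle set `H` follow, by the exchange with 0, from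
    -- those on `F` and `G`. The masks of the outer sets leave the sum, and what remains is the
    -- square of the full boundary operator.
    BA : B · A ≋ 𝟘
    BA = pointwise λ G F →
      trans (∑-cong (sub n) (term G F))
      (trans (∑-*ˡ (sub n) _ _) (trans (*-congˡ (∂∂≈0 G F)) (zeroʳ _)))
      where
      term : ∀ G F H → at B G H * at A H F ≈ ([ not (con K′ G) ] * [ del K F ]) * (∂ G H * ∂ H F)
      term G F H with ∂-support G H | ∂-support H F | T? (not (con K′ G)) | T? (del K F)
      ... | inj₁ z | _      | _      | _      = trans
        (trans (*-congʳ (trans (*-congʳ (trans (*-congˡ z) (zeroʳ _))) (zeroˡ _))) (zeroˡ _))
        (sym (trans (*-congˡ (trans (*-congʳ z) (zeroˡ _))) (zeroʳ _)))
      ... | inj₂ s | inj₁ z | _      | _      = trans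
        (trans (*-congˡ (trans (*-congʳ (trans (*-congˡ z) (zeroʳ _))) (zeroˡ _))) (zeroʳ _))
        (sym (trans (*-congˡ (trans (*-congˡ z) (zeroʳ _))) (zeroʳ _)))
      ... | inj₂ s | inj₂ t | no G∈  | _      = trans
        (trans (*-congʳ (trans (*-congʳ (trans (*-congʳ ([F] G∈)) (zeroˡ _))) (zeroˡ _))) (zeroˡ _))
        (sym (trans (*-congʳ (trans (*-congʳ ([F] G∈)) (zeroˡ _))) (zeroˡ _)))
      ... | inj₂ s | inj₂ t | yes G∉ | no F∉  = trans
        (trans (*-congˡ (trans (*-congˡ ([F] F∉)) (zeroʳ _))) (zeroʳ _))
        (sym (trans (*-congʳ (trans (*-congˡ ([F] F∉)) (zeroʳ _))) (zeroˡ _)))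
      ... | inj₂ s | inj₂ t | yes G∉ | yes F∈ = trans
        (*-cong (∂M-unmasked (con K) (con K′) G∉ H∈) (∂M-unmasked (del K) (del K′) H∉ F∈))
        (sym (trans (*-congʳ (trans (*-cong ([T] G∉) ([T] F∈)) (*-identityˡ _))) (*-identityˡ _)))
        where
        H∈ : T (con K H)
        H∈ = K↓ (swap t) F∈

        H∉ : T (not (del K′ H))
        H∉ = T-not (λ H∈′ → not-T G∉ (K′↓ (swap s) H∈′))

    1ᵀ : One ᵀ ≋ One
    1ᵀ = diag-ᵀ ([_] ∘ m)

    1-1 : One · One ≋ One
    1-1 = ≋-trans (diag-· ([_] ∘ m) One) (pointwise λ G F → idem (m G) (equal G F))
      where
      idem : ∀ b x → [ b ] * ([ b ] * x) ≈ [ b ] * x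
      idem true  x = *-identityˡ _
      idem false x = trans (zeroˡ _) (sym (zeroˡ x))

    1-1ᵀ : One · One ᵀ ≋ One
    1-1ᵀ = ≋-trans (·-congˡ 1ᵀ) 1-1

    1ᵀ-1 : One ᵀ · One ≋ One
    1ᵀ-1 = ≋-trans (·-congʳ 1ᵀ) 1-1

    private
      neg-· : ∀ (M : Mat (sub n) (sub n)) G F →
              ∑ (sub n) (λ H → - at B G H * at M H F) ≈ - at (B · M) G F
      neg-· M G F = trans (∑-cong (sub n) λ H → sym (-‿distribˡ-* _ _))
                          (∑-neg (sub n) (λ H → at B G H * at M H F))

    -- The blocks of `Y · X ᵀ` are `One · A`, `One · One ᵀ`, `- (B · A)` and `- (B · One ᵀ)`. Those
    -- of `∂M K K′` are `A`, a masked identity, 0 and `- B`.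
    D≋ : ∂M K K′ ≋ Y · X ᵀ
    D≋ = pointwise λ G F → sym (go G F)
      where
      -- `One` tests both masks at `G`, the boundary matrix tests one at `G` and one at `F`; on the
      -- support of `equal` this is the same.
      diagonal : ∀ G F → [ m G ] * equal G F ≈ [ not (del K′ G) ] * equal G F * [ con K F ]
      diagonal G F with equal-support G F
      ... | inj₁ z = trans (trans (*-congˡ z) (zeroʳ _))
                           (sym (trans (*-congʳ (trans (*-congˡ z) (zeroʳ _))) (zeroˡ _)))
      ... | inj₂ ≡.refl with con K F
      ...   | true  = sym (*-identityʳ _)
      ...   | false = trans (zeroˡ _) (sym (zeroʳ _))

      go : ∀ G F → at (Y · X ᵀ) G F ≈ at (∂M K K′) G F
      go (outside ∷ G) (outside ∷ F) = entry 1A G F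
      go (outside ∷ G) (inside  ∷ F) = trans (entry 1-1ᵀ G F) (diagonal G F)
      go (inside  ∷ G) (outside ∷ F) =
        trans (neg-· A G F) (trans (trans (-‿cong (entry BA G F)) -0#≈0#)
              (sym (trans (*-congʳ (zeroʳ _)) (zeroˡ _))))
      go (inside  ∷ G) (inside  ∷ F) =
        trans (neg-· (One ᵀ) G F)
        (trans (-‿cong (entry (≋-trans (·-congˡ 1ᵀ) B1) G F))
        (trans (-‿distribˡ-* _ _) (*-congʳ (-‿distribʳ-* _ _))))

    YY : Y ᵀ · Y ≋ One ⊕ B ᵀ · B
    YY = pointwise λ H H′ → trans (∑-sub _)
      (+-cong (entry 1ᵀ-1 H H′) (∑-cong (sub n) λ G → -x*-y _ _))

    XX : X ᵀ · X ≋ One ⊕ A · A ᵀ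
    XX = pointwise λ G G′ → trans (∑-sub _) (trans (+-cong refl (entry 1ᵀ-1 G G′)) (+-comm _ _))

    1X : One · X ᵀ ≋ X ᵀ
    1X = pointwise λ G F → go G F
      where
      go : ∀ G F → at (One · X ᵀ) G F ≈ at (X ᵀ) G F
      go G (outside ∷ F) = entry 1A G F
      go G (inside  ∷ F) = trans (entry 1-1ᵀ G F) (entry 1ᵀ F G)

    tr-One : tr One ≈ ι (count m (subsets n))
    tr-One = trans (tr-diag ([_] ∘ m)) (trans (∑-sum (sub n) ([_] ∘ m))
      (trans (sum-lookup (subsets n) ([_] ∘ m)) (listSum-count m (subsets n))))

  del-closed : ∀ {n} {K : Subset (suc n) → Bool} → Closed K → Closed (del K)
  del-closed K↓ F⊴G = K↓ (keep F⊴G)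

  con-closed : ∀ {n} {K : Subset (suc n) → Bool} → Closed K → Closed (con K)
  con-closed K↓ F⊴G = K↓ (keep F⊴G)

  module SpectralProjections (inv : ℕ → Carrier) (ι-inv : ∀ a → ι (suc a) * inv a ≈ 1#) where
    open Invertible inv ι-inv

    -- `complete` says that the eigenvalues 1 up to n account for everything that `∂M K K′` does not
    -- kill.
    record Decomposition {n} (K K′ : Subset n → Bool) : Set (c ⊔ ℓ) where
      field
        E        : ℕ → Mat (sub n) (sub n)
        eigen    : Eigen (∂M K K′ ᵀ · ∂M K K′) E
        complete : ∂M K K′ · ΣM n E ≋ ∂M K K′
        trace    : ∀ a → tr (E a) + ι (deg n K K′ (suc a)) ≈ ι (deg n K K′ a)

    decompose : ∀ n {K K′ : Subset n → Bool} → Closed K → Closed K′ → Decomposition K K′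
    decompose zero {K} {K′} _ _ = record
      { E        = λ _ → 𝟘
      ; eigen    = record
        { left  = λ a → ≋-trans (·-𝟘 _) (≋-sym (⊛-𝟘 _))
        ; right = λ a → ≋-trans (𝟘-· _) (≋-sym (⊛-𝟘 _))
        }
      -- The empty set is the only index and has no boundary, so the matrix is zero.
      ; complete = ≋-trans (·-𝟘 _) (pointwise λ { [] [] → sym (trans (*-congʳ (zeroʳ _)) (zeroˡ _)) })
      ; trace    = λ a → trans (+-identityʳ _) (∑-0 (sub 0) λ _ → refl)
      }
    decompose (suc n) {K} {K′} K↓ K′↓ = record
      { E        = Step.E step n D₀.eigen D₁.eigen D₀.complete D₁.complete
      ; eigen    = Step.step-Eigen step n D₀.eigen D₁.eigen D₀.complete D₁.complete
      ; complete = Step.step-complete step n D₀.eigen D₁.eigen D₀.complete D₁.complete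
      ; trace    = Step.step-tr step n D₀.eigen D₁.eigen D₀.complete D₁.complete
          (deg n (del K) (del K′)) (deg n (con K) (con K′)) D₀.trace D₁.trace
          (deg-vanish n (del K) (del K′) ℕ.≤-refl) (deg-vanish n (con K) (con K′) ℕ.≤-refl) S.tr-One
      }
      where
      module S = Split K K′ K↓ K′↓
      module D₀ = Decomposition (decompose n (del-closed K↓) (del-closed K′↓))
      module D₁ = Decomposition (decompose n (con-closed K↓) (con-closed K′↓))

      step : Step
      step = record
        { D  = ∂M K K′
        ; A  = S.A ; B = S.B ; One = S.One ; X = S.X ; Y = S.Y
        ; D≋ = S.D≋ ; YY = S.YY ; XX = S.XX ; 1A = S.1A ; B1 = S.B1 ; BA = S.BA
        ; 1-1 = S.1-1 ; 1ᵀ = S.1ᵀ ; 1X = S.1X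
        }

-- Counting in lists, positions of elements, and the degrees as counts.

module _ {a} {A : Set a} where

  filter-does : ∀ {p q} {P : Pred A p} {Q : Pred A q} (P? : Decidable P) (Q? : Decidable Q) →
                (∀ x → does (P? x) ≡ does (Q? x)) → ∀ xs → filter P? xs ≡ filter Q? xs
  filter-does P? Q? eq []       = ≡.refl
  filter-does P? Q? eq (x ∷ xs) with does (P? x) | does (Q? x) | eq x
  ... | true  | _ | ≡.refl = ≡.cong (x ∷_) (filter-does P? Q? eq xs)
  ... | false | _ | ≡.refl = filter-does P? Q? eq xs

  filter-map : ∀ {b p} {B : Set b} {P : Pred B p} (P? : Decidable P) (f : A → B) xs →
               filter P? (map f xs) ≡ map f (filter (P? ∘ f) xs)
  filter-map P? f []       = ≡.refl
  filter-map P? f (x ∷ xs) with does (P? (f x))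
  ... | true  = ≡.cong (f x ∷_) (filter-map P? f xs)
  ... | false = filter-map P? f xs

  count-filter : ∀ (p q : A → Bool) xs → count p (filterᵇ q xs) ≡ count (λ x → q x ∧ p x) xs
  count-filter p q []       = ≡.refl
  count-filter p q (x ∷ xs) with q x
  ... | false = count-filter p q xs
  ... | true  with p x
  ...   | true  = ≡.cong suc (count-filter p q xs)
  ...   | false = count-filter p q xs

  count-cong : ∀ {p q : A → Bool} → (∀ x → p x ≡ q x) → ∀ xs → count p xs ≡ count q xs
  count-cong {p} {q} eq xs = ≡.cong length (filter-does (T? ∘ p) (T? ∘ q) eq xs)

  count-++ : ∀ (p : A → Bool) xs ys → count p (xs ++ ys) ≡ count p xs ℕ.+ count p ys
  count-++ p xs ys = ≡.trans (≡.cong length (filter-++ (T? ∘ p) xs ys)) (length-++ (filterᵇ p xs))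

  count-none : ∀ (xs : List A) → count (λ _ → false) xs ≡ 0
  count-none []       = ≡.refl
  count-none (x ∷ xs) = count-none xs

count-map : ∀ {a b} {A : Set a} {B : Set b} (p : B → Bool) (f : A → B) xs →
            count p (map f xs) ≡ count (p ∘ f) xs
count-map p f xs = ≡.trans (≡.cong length (filter-map (T? ∘ p) f xs)) (length-map f (filterᵇ (p ∘ f) xs))

count-subsets : ∀ {n} (p : Subset (suc n) → Bool) →
                count p (subsets (suc n)) ≡ count (del p) (subsets n) ℕ.+ count (con p) (subsets n)
count-subsets {n} p = ≡.trans (count-++ p (map (outside ∷_) (subsets n)) _)
  (≡.cong₂ ℕ._+_ (count-map p (outside ∷_) (subsets n)) (count-map p (inside ∷_) (subsets n)))

module _ {n} (F : Subset n) where

  private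
    tail-positions : ∀ b → filter (_∈? (b ∷ F)) (tabulate Fin.suc) ≡ map Fin.suc (positions F)
    tail-positions b =
      ≡.trans (≡.cong (filter (_∈? (b ∷ F))) (≡.sym (map-tabulate id Fin.suc)))
      (≡.trans (filter-map (_∈? (b ∷ F)) Fin.suc (allFin n))
      (≡.cong (map Fin.suc) (filter-does ((_∈? (b ∷ F)) ∘ Fin.suc) (_∈? F) (λ _ → ≡.refl) (allFin n))))

  positions-outside : positions (outside ∷ F) ≡ map Fin.suc (positions F)
  positions-outside = tail-positions outside

  positions-inside : positions (inside ∷ F) ≡ Fin.zero ∷ map Fin.suc (positions F)
  positions-inside = ≡.cong (Fin.zero ∷_) (tail-positions inside)

below : ∀ {n} → Subset n → Fin n → ℕ
below F v = length (filter (_<? v) (positions F))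

private
  below-suc : ∀ {n} (ps : List (Fin n)) (v : Fin n) →
              length (filter (_<? Fin.suc v) (map Fin.suc ps)) ≡ length (filter (_<? v) ps)
  below-suc ps v = ≡.trans (≡.cong length (filter-map (_<? Fin.suc v) Fin.suc ps))
    (≡.trans (length-map Fin.suc (filter ((_<? Fin.suc v) ∘ Fin.suc) ps))
             (≡.cong length (filter-does ((_<? Fin.suc v) ∘ Fin.suc) (_<? v) (λ _ → ≡.refl) ps)))

  below-0 : ∀ {n} (ps : List (Fin (suc n))) → length (filter (_<? Fin.zero {n}) ps) ≡ 0
  below-0 []       = ≡.refl
  below-0 (p ∷ ps) = below-0 ps

below-outside : ∀ {n} (F : Subset n) v → below (outside ∷ F) (Fin.suc v) ≡ below F v
below-outside F v =
  ≡.trans (≡.cong (λ ps → length (filter (_<? Fin.suc v) ps)) (positions-outside F))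
          (below-suc (positions F) v)

below-inside : ∀ {n} (F : Subset n) v → below (inside ∷ F) (Fin.suc v) ≡ suc (below F v)
below-inside F v =
  ≡.trans (≡.cong (λ ps → length (filter (_<? Fin.suc v) ps)) (positions-inside F))
          (≡.cong suc (below-suc (positions F) v))

without-zero : ∀ {n} b (F : Subset n) → (b ∷ F) without Fin.zero ≡ outside ∷ F
without-zero b F = ≡.cong (outside ∷_) (p─⊥≡p F)

◃-without : ∀ {n} {F : Subset n} {v} → v ∈ F → F without v ◃ F
◃-without {F = _ ∷ F} here = ≡.subst (_◃ inside ∷ F) (≡.sym (without-zero inside F)) here
◃-without (there v∈F)      = there (◃-without v∈F)

◃-size : ∀ {n k} {G F : Subset n} → G ◃ F → ∣ F ∣ ≡ suc k → ∣ G ∣ ≡ k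
◃-size here eq = ℕ.suc-injective eq
◃-size {k = k} (there {b = outside} s) eq = ◃-size s eq
◃-size {k = zero}  (there {b = inside} {F = F} s) eq = contradiction (ℕ.suc-injective eq) (nonempty s)
  where
  nonempty : ∀ {n} {G F : Subset n} → G ◃ F → ¬ (∣ F ∣ ≡ 0)
  nonempty (there {b = outside} s) eq = nonempty s eq
◃-size {k = suc k} (there {b = inside} s) eq = ≡.cong suc (◃-size s (ℕ.suc-injective eq))

◃-⊆ : ∀ {n} {G F : Subset n} → G ◃ F → G ⊆ F
◃-⊆ here      = out⊆ (λ v∈ → v∈)
◃-⊆ (there s) = s⊆s (λ v∈ → ◃-⊆ s v∈)

◃-bd : ∀ {n k} (K : Family n (suc k)) {G F} → F ∈ᶠ K → G ◃ F → G ∈ᶠ bd K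
◃-bd K {F = F} F∈ s = fromWitness (◃-size s (uniform K F∈) , F , F∈ , λ {_} → ◃-⊆ s)

T-≡ : ∀ {b b′} → (T b → T b′) → (T b′ → T b) → b ≡ b′
T-≡ {true}  {true}  _ _ = ≡.refl
T-≡ {true}  {false} f _ = ⊥-elim (f tt)
T-≡ {false} {true}  _ g = ⊥-elim (g tt)
T-≡ {false} {false} _ _ = ≡.refl

-- A set covered by a member of `K` lies in `bd K`, and there the identification of pairs makes `K′`
-- and `K″` agree.
SamePair-bd : ∀ {n k} (K : Family n (suc k)) {K′ K″ : Family n k} → SamePair K K′ K″ →
              ∀ {F G} → F ∈ᶠ K → G ◃ F → member K′ G ≡ member K″ G
SamePair-bd K same {G = G} F∈ s = T-≡
  (λ G∈ → proj₂ (Equivalence.to   (same G) (◃-bd K F∈ s , G∈)))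
  (λ G∈ → proj₂ (Equivalence.from (same G) (◃-bd K F∈ s , G∈)))

private
  removable : ∀ {n} → (Subset n → Bool) → (Subset n → Bool) → Fin n → Subset n → Bool
  removable K K′ v F = K F ∧ (not (K′ (F without v)) ∧ does (v ∈? F))

  removable-deg : ∀ {n} (K K′ : Subset n → Bool) v →
                  count (removable K K′ v) (subsets n) ≡ deg n K K′ (Fin.toℕ v)
  removable-deg {suc n} K K′ Fin.zero = ≡.trans (count-subsets (removable K K′ Fin.zero))
    (≡.cong₂ ℕ._+_
      (≡.trans (count-cong (λ F → ≡.trans (≡.cong (del K F ∧_) (∧-zeroʳ _)) (∧-zeroʳ _)) (subsets n))
               (count-none (subsets n)))
      (count-cong (λ F → ≡.cong (con K F ∧_) (≡.trans (∧-comm _ true)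
        (≡.cong (not ∘ K′) (without-zero inside F)))) (subsets n)))
  removable-deg {suc n} K K′ (Fin.suc v) = ≡.trans (count-subsets (removable K K′ (Fin.suc v)))
    (≡.cong₂ ℕ._+_ (removable-deg (del K) (del K′) v) (removable-deg (con K) (con K′) v))

-- The degree consults `K′` only at `F without v` with `v` in `F`. Such sets lie in `bd K`, so the
-- shifted representative `K″` may take the place of `K′`.
degree-deg : ∀ {n k} (K : Family n (suc k)) (K′ K″ : Family n k) → SamePair K K′ K″ →
             ∀ v → degree K K′ v ≡ deg n (member K) (member K″) (Fin.toℕ v)
degree-deg {n} K K′ K″ same v =
  ≡.trans (≡.cong length (filter-does (v ∈?_) (T? ∘ (λ F → does (v ∈? F))) (λ _ → ≡.refl)
                                      (filterᵇ kept (faces K))))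
  (≡.trans (count-filter (λ F → does (v ∈? F)) kept (faces K))
  (≡.trans (count-filter (λ F → kept F ∧ does (v ∈? F)) (member K) (subsets n))
  (≡.trans (count-cong mask (subsets n)) (removable-deg (member K) (member K″) v))))
  where
  kept : Subset n → Bool
  kept F = not (member K′ (F without v))

  mask : ∀ F → removable (member K) (member K′) v F ≡ removable (member K) (member K″) v F
  mask F with T? (member K F) | v ∈? F
  ... | no F∉  | _      = ≡.trans (≡.cong (_∧ _) F≡) (≡.sym (≡.cong (_∧ _) F≡))
    where F≡ = T-≡ {member K F} {false} F∉ λ ()
  ... | yes _  | no _   = ≡.cong (member K F ∧_) (≡.trans (∧-zeroʳ _) (≡.sym (∧-zeroʳ _)))
  ... | yes F∈ | yes v∈ = ≡.cong (λ b → member K F ∧ (not b ∧ true))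
                            (SamePair-bd K {K′} {K″} same F∈ (◃-without v∈))

-- Shifted families are closed under single replacements.

module _ (E : GroundSet) where
  open GroundSet E

  private
    Monotone : ∀ {n} → (Fin n → ℤ) → Set
    Monotone f = ∀ {i j} → i Fin.< j → f i ℤ.≤ f j

    tail-mono : ∀ {n} {f : Fin (suc n) → ℤ} → Monotone f → Monotone (f ∘ Fin.suc)
    tail-mono mono i<j = mono (ℕ.s≤s i<j)

    values : ∀ {n} → (Fin n → ℤ) → Subset n → List ℤ
    values f F = map f (positions F)

    values-outside : ∀ {n} f (F : Subset n) → values f (outside ∷ F) ≡ values (f ∘ Fin.suc) F
    values-outside f F = ≡.trans (≡.cong (map f) (positions-outside F)) (≡.sym (map-∘ (positions F)))

    values-inside : ∀ {n} f (F : Subset n) →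
                    values f (inside ∷ F) ≡ f Fin.zero ∷ values (f ∘ Fin.suc) F
    values-inside f F = ≡.trans (≡.cong (map f) (positions-inside F))
      (≡.cong (f Fin.zero ∷_) (≡.sym (map-∘ (positions F))))

    values-∷ : ∀ {n} f b {F G : Subset n} → Pointwise ℤ._≤_ (values (f ∘ Fin.suc) F) (values (f ∘ Fin.suc) G) →
               Pointwise ℤ._≤_ (values f (b ∷ F)) (values f (b ∷ G))
    values-∷ f outside {F} {G} p = ≡.subst₂ (Pointwise ℤ._≤_)
      (≡.sym (values-outside f F)) (≡.sym (values-outside f G)) p
    values-∷ f inside  {F} {G} p = ≡.subst₂ (Pointwise ℤ._≤_)
      (≡.sym (values-inside f F)) (≡.sym (values-inside f G)) (ℤ.≤-refl ∷ p)

    -- Up to the deleted element, prepending `x` moves the entries of `G` one place to the right, so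
    -- each meets the next larger entry of `F`; behind it the two lists coincide. On passing an
    -- element of `F`, the recursion makes that element the new lower bound.
    insert : ∀ {n} {f : Fin n → ℤ} {x} {G F : Subset n} → Monotone f → (∀ i → x ℤ.≤ f i) → G ◃ F →
             Pointwise ℤ._≤_ (x ∷ values f G) (values f F)
    insert {f = f} {x} mono x≤ (here {F = F}) = ≡.subst₂ (λ G F → Pointwise ℤ._≤_ (x ∷ G) F)
      (≡.sym (values-outside f F)) (≡.sym (values-inside f F))
      (x≤ Fin.zero ∷ Pointwise.refl ℤ.≤-refl)
    insert {f = f} {x} mono x≤ (there {b = outside} {G} {F} s) =
      ≡.subst₂ (λ G F → Pointwise ℤ._≤_ (x ∷ G) F)
        (≡.sym (values-outside f G)) (≡.sym (values-outside f F))
        (insert (tail-mono mono) (x≤ ∘ Fin.suc) s)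
    insert {f = f} {x} mono x≤ (there {b = inside} {G} {F} s) =
      ≡.subst₂ (λ G F → Pointwise ℤ._≤_ (x ∷ G) F)
        (≡.sym (values-inside f G)) (≡.sym (values-inside f F))
        (x≤ Fin.zero ∷ insert (tail-mono mono) (λ i → mono (ℕ.s≤s ℕ.z≤n)) s)

    ⊴⇒Pointwise : ∀ {n} {f : Fin n → ℤ} {F G} → Monotone f → F ⊴ G →
                  Pointwise ℤ._≤_ (values f F) (values f G)
    ⊴⇒Pointwise {f = f} mono (swap {G = G} {F} s) = ≡.subst₂ (Pointwise ℤ._≤_)
      (≡.sym (values-inside f G)) (≡.sym (values-outside f F))
      (insert (tail-mono mono) (λ i → mono (ℕ.s≤s ℕ.z≤n)) s)
    ⊴⇒Pointwise {f = f} mono (keep {b = b} F⊴G) = values-∷ f b (⊴⇒Pointwise (tail-mono mono) F⊴G)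

  shifted⇒closed : ∀ {k} (K : Family size k) → Shifted E K → Closed (member K)
  shifted⇒closed K sh {F} {G} F⊴G = sh F G (⊴⇒Pointwise (λ i<j → ℤ.<⇒≤ (increasing i<j)) F⊴G)

-- The given Laplacian as a restriction of the one on all subsets.

module Laplacians {c ℓ} (R : CommutativeRing c ℓ) where
  open Matrices R
  open BoundaryMatrices R
  open Chains R using (sign; incidence; laplacian; _^_)
  open CommutativeRing R
  open RingProperties ring using (-‿distribˡ-*; -‿+-comm; -0#≈0#)
  open SemiringSum semiring using (sum; sum-cong-≋)
  open Index

  private
    when : ∀ {p} {P : Set p} → Dec P → Carrier → Carrier
    when d x = if ⌊ d ⌋ then x else 0#

    when-no : ∀ {p} {P : Set p} (d : Dec P) {x} → ¬ P → when d x ≈ 0#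
    when-no (yes p) ¬p = contradiction p ¬p
    when-no (no _)  _  = refl

    when-cong : ∀ {p q} {P : Set p} {Q : Set q} (d : Dec P) (e : Dec Q) {x y} →
                (P → Q) → (Q → P) → x ≈ y → when d x ≈ when e y
    when-cong (yes p) (yes q) _ _ eq = eq
    when-cong (yes p) (no ¬q) f _ _  = contradiction (f p) ¬q
    when-cong (no ¬p) (yes q) _ g _  = contradiction (g q) ¬p
    when-cong (no ¬p) (no ¬q) _ _ _  = refl

    when-neg : ∀ {p} {P : Set p} (d : Dec P) {x} → when d (- x) ≈ - when d x
    when-neg (yes _) = refl
    when-neg (no _)  = sym -0#≈0#

    removes? : ∀ {n} (F G : Subset n) v → Dec (v ∈ F × F without v ≡ G)
    removes? F G v = (v ∈? F) ×-dec ≡-dec Bool._≟_ (F without v) G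

    sign-zero : ∀ {n} b (F : Subset n) → sign (b ∷ F) Fin.zero ≈ 1#
    sign-zero b F = reflexive (≡.cong ((- 1#) ^_) (below-0 (positions (b ∷ F))))

    sign-outside : ∀ {n} (F : Subset n) v → sign (outside ∷ F) (Fin.suc v) ≈ sign F v
    sign-outside F v = reflexive (≡.cong ((- 1#) ^_) (below-outside F v))

    sign-inside : ∀ {n} (F : Subset n) v → sign (inside ∷ F) (Fin.suc v) ≈ - sign F v
    sign-inside F v = trans (reflexive (≡.cong ((- 1#) ^_) (below-inside F v)))
      (trans (sym (-‿distribˡ-* 1# _)) (-‿cong (*-identityˡ _)))

    sum-neg : ∀ {n} (f : Fin n → Carrier) → sum (λ i → - f i) ≈ - sum f
    sum-neg {zero}  f = sym -0#≈0#
    sum-neg {suc n} f = trans (+-congˡ (sum-neg (f ∘ Fin.suc))) (-‿+-comm _ _)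

  -- The summand of the vertex 0 survives only when `F` contains 0 and `G` does not, and then it is
  -- the only one. If both contain 0, every other vertex has one more element of `F` below it,
  -- whence the minus sign.
  incidence≈∂ : ∀ {n} (G F : Subset n) → incidence G F ≈ ∂ G F
  incidence≈∂ []            []            = refl
  incidence≈∂ (outside ∷ G) (outside ∷ F) =
    trans (+-cong (when-no (removes? (outside ∷ F) (outside ∷ G) Fin.zero) {sign (outside ∷ F) Fin.zero} λ { (() , _) })
      (sum-cong-≋ λ v → when-cong (removes? (outside ∷ F) (outside ∷ G) (Fin.suc v)) (removes? F G v)
        (λ { (there v∈ , eq) → v∈ , ∷-injectiveʳ eq })
        (λ { (v∈ , eq) → there v∈ , ≡.cong (outside ∷_) eq })
        (sign-outside F v)))
    (trans (+-identityˡ _) (incidence≈∂ G F))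
  incidence≈∂ {suc n} (outside ∷ G) (inside ∷ F) =
    trans (+-cong (head (removes? (inside ∷ F) (outside ∷ G) Fin.zero))
      (sum-zero λ v → when-no (removes? (inside ∷ F) (outside ∷ G) (Fin.suc v)) λ { (_ , ()) }))
    (+-identityʳ _)
    where
    head : (d : Dec (Fin.zero ∈ inside ∷ F × (inside ∷ F) without Fin.zero ≡ outside ∷ G)) →
           when d (sign (inside ∷ F) Fin.zero) ≈ equal G F
    head (yes (_ , eq)) with ≡.trans (≡.sym (without-zero inside F)) eq
    ... | ≡.refl = trans (sign-zero inside F) (sym (equal-refl F))
    head (no ¬p) with equal-support G F
    ... | inj₁ z      = sym z
    ... | inj₂ ≡.refl = contradiction (here , without-zero inside F) ¬p
  incidence≈∂ (inside ∷ G) (outside ∷ F) =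
    trans (+-cong (when-no (removes? (outside ∷ F) (inside ∷ G) Fin.zero) {sign (outside ∷ F) Fin.zero} λ { (() , _) })
      (sum-zero λ v → when-no (removes? (outside ∷ F) (inside ∷ G) (Fin.suc v)) λ { (_ , ()) }))
    (+-identityʳ _)
  incidence≈∂ (inside ∷ G) (inside ∷ F) =
    trans (+-cong (when-no (removes? (inside ∷ F) (inside ∷ G) Fin.zero) {sign (inside ∷ F) Fin.zero} λ { (_ , ()) })
      (trans (sum-cong-≋ λ v → trans
        (when-cong (removes? (inside ∷ F) (inside ∷ G) (Fin.suc v)) (removes? F G v)
          (λ { (there v∈ , eq) → v∈ , ∷-injectiveʳ eq })
          (λ { (v∈ , eq) → there v∈ , ≡.cong (inside ∷_) eq })
          (sign-inside F v))
        (when-neg (removes? F G v)))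
      (sum-neg (λ v → when (removes? F G v) (sign F v)))))
    (trans (+-identityˡ _) (-‿cong (incidence≈∂ G F)))

  finEqual : ∀ {n} → Fin n → Fin n → Carrier
  finEqual Fin.zero    Fin.zero    = 1#
  finEqual Fin.zero    (Fin.suc j) = 0#
  finEqual (Fin.suc i) Fin.zero    = 0#
  finEqual (Fin.suc i) (Fin.suc j) = finEqual i j

  fin : ℕ → Index
  fin n = record
    { El     = Fin n
    ; enum   = id
    ; δ      = finEqual
    ; δ-refl = equal-refl′
    ; δ-sym  = equal-sym′
    ; sum-δ  = sum-equal′
    }
    where
    equal-refl′ : ∀ {n} (i : Fin n) → finEqual i i ≈ 1#
    equal-refl′ Fin.zero    = refl
    equal-refl′ (Fin.suc i) = equal-refl′ i

    equal-sym′ : ∀ {n} (i j : Fin n) → finEqual i j ≈ finEqual j i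
    equal-sym′ Fin.zero    Fin.zero    = refl
    equal-sym′ Fin.zero    (Fin.suc j) = refl
    equal-sym′ (Fin.suc i) Fin.zero    = refl
    equal-sym′ (Fin.suc i) (Fin.suc j) = equal-sym′ i j

    sum-equal′ : ∀ {n} (i : Fin n) (f : Fin n → Carrier) → sum (λ j → finEqual i j * f j) ≈ f i
    sum-equal′ Fin.zero    f =
      trans (+-cong (*-identityˡ _) (sum-zero {f = λ j → 0# * f (Fin.suc j)} λ _ → zeroˡ _)) (+-identityʳ _)
    sum-equal′ (Fin.suc i) f =
      trans (+-cong (zeroˡ _) (sum-equal′ i (f ∘ Fin.suc))) (+-identityˡ _)

  ∑-filter : ∀ {n} (p : Subset n → Bool) (f : Subset n → Carrier) →
             sum (λ i → f (lookup (filterᵇ p (subsets n)) i)) ≈ ∑ (sub n) (λ F → [ p F ] * f F)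
  ∑-filter {n} p f =
    trans (sum-lookup (filterᵇ p (subsets n)) f)
    (trans (listSum-filter p (subsets n) f)
    (trans (sym (sum-lookup (subsets n) (λ F → [ p F ] * f F))) (sym (∑-sum (sub n) _))))

  []-idem : ∀ b → [ b ] * [ b ] ≈ [ b ]
  []-idem true  = *-identityˡ _
  []-idem false = zeroˡ _

  module Restriction {n k} (K : Family n k) where

    mask : Mat (sub n) (sub n)
    mask = diag ([_] ∘ member K)

    restrict : Mat (sub n) (sub n) → Mat (fin (card K)) (fin (card K))
    restrict M = mat λ i j → at M (face K i) (face K j)

    -- `M · mask ≋ M` says that the columns of `M` outside `K` vanish, so the inner sum over all
    -- subsets is a sum over the faces of `K`.
    restrict-· : ∀ {M} N → M · mask ≋ M → restrict (M · N) ≋ restrict M · restrict N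
    restrict-· {M} N masked = pointwise λ i j → sym
      (trans (∑-sum (fin (card K)) _)
      (trans (∑-filter (member K) (λ F → at M (face K i) F * at N F (face K j)))
      (∑-cong (sub n) λ F → trans (sym (*-assoc _ _ _)) (*-congʳ (trans (*-comm _ _)
        (entry (≋-trans (≋-sym (·-diag ([_] ∘ member K) M)) masked) (face K i) F))))))

    restrict-tr : ∀ {M} → M · mask ≋ M → tr (restrict M) ≈ tr M
    restrict-tr {M} masked =
      trans (∑-sum (fin (card K)) _)
      (trans (∑-filter (member K) (λ F → at M F F))
      (∑-cong (sub n) λ F → trans (*-comm _ _)
        (entry (≋-trans (≋-sym (·-diag ([_] ∘ member K) M)) masked) F F)))

    restrict-cong : ∀ {M N} → M ≋ N → restrict M ≋ restrict N
    restrict-cong p = pointwise λ i j → entry p (face K i) (face K j)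

    restrict-ΣM : ∀ m E → restrict (ΣM m E) ≋ ΣM m (restrict ∘ E)
    restrict-ΣM zero    E = ≋-refl
    restrict-ΣM (suc m) E = ⊕-cong ≋-refl (restrict-ΣM m (E ∘ suc))

  module _ {n k} (K : Family n (suc k)) (K′ K″ : Family n k) (same : SamePair K K′ K″) where
    open Restriction K

    private
      D : Mat (sub n) (sub n)
      D = ∂M (member K) (member K″)

    ∂M-mask : D · mask ≋ D
    ∂M-mask = ≋-trans (·-diag ([_] ∘ member K) D) (pointwise λ G F →
      trans (*-assoc _ _ _) (*-congˡ ([]-idem (member K F))))

    face-∈ : ∀ i → face K i ∈ᶠ K
    face-∈ i = All.lookup (Allₚ.all-filter (T? ∘ member K) (subsets n)) (∈-lookup i)

    -- A row `G` contributes only if it is covered by `face K i`. It then belongs to `bd K`, and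
    -- `K′` agrees with `K″` there, so both Laplacians sum over the same rows.
    laplacian≋ : mat (laplacian K K′) ≋ restrict (D ᵀ · D)
    laplacian≋ = pointwise λ i j →
      trans (∑-filter (member (bd K ∖ K′)) (λ G → incidence G (face K i) * incidence G (face K j)))
            (∑-cong (sub n) λ G → trans
              (*-congˡ (*-cong (incidence≈∂ G (face K i)) (incidence≈∂ G (face K j))))
              (masks i j G))
      where
      masks : ∀ i j G → [ member (bd K ∖ K′) G ] * (∂ G (face K i) * ∂ G (face K j))
                        ≈ at D G (face K i) * at D G (face K j)
      masks i j G with ∂-support G (face K i)
      ... | inj₁ z = trans (trans (*-congˡ (trans (*-congʳ z) (zeroˡ _))) (zeroʳ _))
        (sym (trans (*-congʳ (trans (*-congʳ (trans (*-congˡ z) (zeroʳ _))) (zeroˡ _))) (zeroˡ _)))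
      ... | inj₂ s = trans (*-congʳ (reflexive (≡.cong [_] both)))
        (trans (split (not (member K″ G)) _ _)
               (*-cong (unmask (face-∈ i)) (unmask (face-∈ j))))
        where
        both : member (bd K ∖ K′) G ≡ not (member K″ G)
        both = ≡.cong₂ _∧_ (T-≡ {b′ = true} (λ _ → tt) (λ _ → ◃-bd K (face-∈ i) s))
                           (≡.cong not (SamePair-bd K {K′} {K″} same (face-∈ i) s))

        split : ∀ b x y → [ b ] * (x * y) ≈ ([ b ] * x) * ([ b ] * y)
        split true  x y = trans (*-identityˡ _) (sym (*-cong (*-identityˡ x) (*-identityˡ y)))
        split false x y = trans (zeroˡ _) (sym (trans (*-congʳ (zeroˡ x)) (zeroˡ _)))

        unmask : ∀ {b x} → T b → x ≈ x * [ b ]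
        unmask {true} _ = sym (*-identityʳ _)

    module _ (inv : ℕ → Carrier) (ι-inv : ∀ a → ι (suc a) * inv a ≈ 1#)
             (K↓ : Closed (member K)) (K″↓ : Closed (member K″)) where
      open Invertible inv ι-inv
      open SpectralProjections inv ι-inv
      open Decomposition (decompose n K↓ K″↓)

      projection : ℕ → Mat (fin (card K)) (fin (card K))
      projection a = restrict (E a)

      private
        L-mask : D ᵀ · D · mask ≋ D ᵀ · D
        L-mask = ≋-trans (·-assoc (D ᵀ) D mask) (·-congˡ ∂M-mask)

        E-mask : ∀ a → E a · mask ≋ E a
        E-mask a = ≋-trans (absorbʳ {Z′ = 𝟙} eigen (≋-trans L-mask (≋-sym (·-𝟙 _))) a) (·-𝟙 _)

      projection-Eigen : Eigen (mat (laplacian K K′)) projection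
      projection-Eigen = Eigen-resp (≋-sym laplacian≋) record
        { left  = λ a → ≋-trans (≋-sym (restrict-· (E a) L-mask)) (restrict-cong (left eigen a))
        ; right = λ a → ≋-trans (≋-sym (restrict-· (D ᵀ · D) (E-mask a))) (restrict-cong (right eigen a))
        }

      projection-complete : mat (laplacian K K′) · ΣM n projection ≋ mat (laplacian K K′)
      projection-complete = begin
        mat (laplacian K K′) · ΣM n projection       ≈⟨ ·-cong laplacian≋ (≋-sym (restrict-ΣM n E)) ⟩
        restrict (D ᵀ · D) · restrict (ΣM n E)       ≈⟨ restrict-· (ΣM n E) L-mask ⟨
        restrict (D ᵀ · D · ΣM n E)                  ≈⟨ restrict-cong (·-assoc (D ᵀ) D (ΣM n E)) ⟩
        restrict (D ᵀ · (D · ΣM n E))                ≈⟨ restrict-cong (·-congˡ {M = D ᵀ} complete) ⟩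
        restrict (D ᵀ · D)                           ≈⟨ laplacian≋ ⟨
        mat (laplacian K K′)                         ∎

      projection-tr : ∀ a → tr (projection a) + ι (deg n (member K) (member K″) (suc a))
                            ≈ ι (deg n (member K) (member K″) a)
      projection-tr a = trans (+-congʳ (restrict-tr (E-mask a))) (trace a)

-- Idempotent matrices over a local ring have free images.

module Idempotents {c ℓ} (R : CommutativeRing c ℓ) where
  open Matrices R
  open Laplacians R using (fin; finEqual)
  open CommutativeRing R
  open RingProperties ring using (-‿distribˡ-*)
  open GroupProperties +-group using (∙-cancelˡ)
  open CommutativeSemigroupProperties *-commutativeSemigroup using (x∙yz≈y∙xz)
  open Index

  ∑-fin : ∀ {n} (f : Fin (suc n) → Carrier) → ∑ (fin (suc n)) f ≈ f Fin.zero + ∑ (fin n) (f ∘ Fin.suc)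
  ∑-fin {n} f = trans (∑-sum (fin (suc n)) f) (+-congˡ (sym (∑-sum (fin n) _)))

  ∑-fin₁ : (f : Fin 1 → Carrier) → ∑ (fin 1) f ≈ f Fin.zero
  ∑-fin₁ f = trans (∑-fin f) (trans (+-congˡ (∑-sum (fin 0) _)) (+-identityʳ _))

  -- The image of `E` is free: the columns of `inc` are a basis and `pro` gives the coordinates.
  record Splitting {I} (E : Mat I I) : Set (lsuc c ⊔ ℓ) where
    field
      rank    : ℕ
      inc     : Mat I (fin rank)
      pro     : Mat (fin rank) I
      inc-pro : inc · pro ≋ E
      pro-inc : pro · inc ≋ 𝟙

    E-inc : E · inc ≋ inc
    E-inc = ≋-trans (·-congʳ (≋-sym inc-pro))
      (≋-trans (·-assoc inc pro inc) (≋-trans (·-congˡ pro-inc) (·-𝟙 inc)))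

    pro-E : pro · E ≋ pro
    pro-E = ≋-trans (·-congˡ (≋-sym inc-pro))
      (≋-trans (≋-sym (·-assoc pro inc pro)) (≋-trans (·-congʳ pro-inc) (𝟙-· pro)))

  tr-𝟙 : ∀ m → tr (𝟙 {fin m}) ≈ ι m
  tr-𝟙 m = trans (∑-sum (fin m) _) (go m)
    where
    open SemiringSum semiring using (sum)
    go : ∀ m → sum (λ i → finEqual {m} i i) ≈ ι m
    go zero    = refl
    go (suc m) = +-congˡ (go m)

  Splitting-tr : ∀ {I} {E : Mat I I} (s : Splitting E) → tr E ≈ ι (Splitting.rank s)
  Splitting-tr s = trans (tr-cong (≋-sym inc-pro))
    (trans (tr-comm inc pro) (trans (tr-cong pro-inc) (tr-𝟙 rank)))
    where open Splitting s

  rank-0 : ∀ {I} {E : Mat I I} (s : Splitting E) → Splitting.rank s ≡ 0 → E ≋ 𝟘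
  rank-0 record { inc-pro = inc-pro } ≡.refl =
    ≋-trans (≋-sym inc-pro) (pointwise λ _ _ → ∑-sum (fin 0) _)

  -- One step of Gaussian elimination on the idempotent E = (x r ; c E₁), with
  -- y = 1 - x.  The pivot is x (z = - 1/x, w = 0) or y (z = 1/y, w = 1).
  module Pivot {n} (E : Mat (fin (suc n)) (fin (suc n))) (EE : E · E ≋ E)
               (y : Carrier) (x+y : at E Fin.zero Fin.zero + y ≈ 1#) where

    x : Carrier
    x = at E Fin.zero Fin.zero

    r : Mat (fin 1) (fin n)
    r = mat λ _ j → at E Fin.zero (Fin.suc j)

    c₁ : Mat (fin n) (fin 1)
    c₁ = mat λ i _ → at E (Fin.suc i) Fin.zero

    E₁ cr : Mat (fin n) (fin n)
    E₁ = mat λ i j → at E (Fin.suc i) (Fin.suc j)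
    cr = c₁ · r

    x+y-* : ∀ u → x * u + y * u ≈ u
    x+y-* u = trans (sym (distribʳ u x y)) (trans (*-congʳ x+y) (*-identityˡ u))

    -- This and the next three are the blocks of `E · E ≋ E`; writing 1 as x + y and cancelling the
    -- summand with x leaves the factor y.
    rc : r · c₁ ≋ (x * y) ⊛ 𝟙
    rc = pointwise λ { Fin.zero Fin.zero → trans
      (∙-cancelˡ (x * x) _ _ (trans (sym (∑-fin _)) (trans (entry EE Fin.zero Fin.zero)
        (trans (sym (*-identityʳ x)) (trans (*-congˡ (sym x+y)) (distribˡ x x y))))))
      (sym (*-identityʳ _)) }

    rE₁ : r · E₁ ≋ y ⊛ r
    rE₁ = pointwise λ { Fin.zero j → ∙-cancelˡ (x * at r Fin.zero j) _ _
      (trans (sym (∑-fin _)) (trans (entry EE Fin.zero (Fin.suc j)) (sym (x+y-* _)))) }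

    E₁c : E₁ · c₁ ≋ y ⊛ c₁
    E₁c = pointwise λ { i Fin.zero → ∙-cancelˡ (at c₁ i Fin.zero * x) _ _
      (trans (sym (∑-fin _)) (trans (entry EE (Fin.suc i) Fin.zero)
        (trans (sym (x+y-* _)) (+-congʳ (*-comm _ _))))) }

    E₁E₁ : cr ⊕ E₁ · E₁ ≋ E₁
    E₁E₁ = pointwise λ i j → trans (+-congʳ (∑-fin₁ _))
      (trans (sym (∑-fin _)) (entry EE (Fin.suc i) (Fin.suc j)))

    -- `zw₁` makes `c₁` and `r` eigenvectors of `E₂` for w, since `E₂ · c₁` has the factor y + z x
    -- y. `zw₂` is the condition on the coefficient of `cr` under which `E₂` is idempotent.
    module Reduce (z w : Carrier) (zw₁ : y + z * (x * y) ≈ w) (zw₂ : z * y + z * w ≈ 1# + z) where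

      E₂ : Mat (fin n) (fin n)
      E₂ = E₁ ⊕ z ⊛ cr

      E₂c : E₂ · c₁ ≋ w ⊛ c₁
      E₂c = begin
        (E₁ ⊕ z ⊛ cr) · c₁                      ≈⟨ ⊕-· E₁ (z ⊛ cr) c₁ ⟩
        E₁ · c₁ ⊕ (z ⊛ cr) · c₁                 ≈⟨ ⊕-cong E₁c (⊛-· z cr c₁) ⟩
        y ⊛ c₁ ⊕ z ⊛ (c₁ · r · c₁)              ≈⟨ ⊕-cong ≋-refl (⊛-cong refl (·-assoc c₁ r c₁)) ⟩
        y ⊛ c₁ ⊕ z ⊛ (c₁ · (r · c₁))            ≈⟨ ⊕-cong ≋-refl (⊛-cong refl
          (≋-trans (·-congˡ rc) (≋-trans (·-⊛ _ c₁ 𝟙) (⊛-cong refl (·-𝟙 c₁))))) ⟩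
        y ⊛ c₁ ⊕ z ⊛ (x * y) ⊛ c₁               ≈⟨ ⊕-cong ≋-refl (⊛-⊛ _ _ c₁) ⟩
        y ⊛ c₁ ⊕ (z * (x * y)) ⊛ c₁             ≈⟨ +-⊛ _ _ c₁ ⟨
        (y + z * (x * y)) ⊛ c₁                  ≈⟨ ⊛-cong zw₁ ≋-refl ⟩
        w ⊛ c₁                                  ∎

      rE₂ : r · E₂ ≋ w ⊛ r
      rE₂ = begin
        r · (E₁ ⊕ z ⊛ cr)                       ≈⟨ ·-⊕ r E₁ (z ⊛ cr) ⟩
        r · E₁ ⊕ r · (z ⊛ cr)                   ≈⟨ ⊕-cong rE₁ (·-⊛ z r cr) ⟩
        y ⊛ r ⊕ z ⊛ (r · (c₁ · r))              ≈⟨ ⊕-cong ≋-refl (⊛-cong refl (·-assoc r c₁ r)) ⟨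
        y ⊛ r ⊕ z ⊛ (r · c₁ · r)                ≈⟨ ⊕-cong ≋-refl (⊛-cong refl
          (≋-trans (·-congʳ rc) (≋-trans (⊛-· _ 𝟙 r) (⊛-cong refl (𝟙-· r))))) ⟩
        y ⊛ r ⊕ z ⊛ (x * y) ⊛ r                 ≈⟨ ⊕-cong ≋-refl (⊛-⊛ _ _ r) ⟩
        y ⊛ r ⊕ (z * (x * y)) ⊛ r               ≈⟨ +-⊛ _ _ r ⟨
        (y + z * (x * y)) ⊛ r                   ≈⟨ ⊛-cong zw₁ ≋-refl ⟩
        w ⊛ r                                   ∎

      E₂E₁ : E₂ · E₁ ≋ E₁ · E₁ ⊕ (z * y) ⊛ cr
      E₂E₁ = begin
        (E₁ ⊕ z ⊛ cr) · E₁                      ≈⟨ ⊕-· E₁ (z ⊛ cr) E₁ ⟩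
        E₁ · E₁ ⊕ (z ⊛ cr) · E₁                 ≈⟨ ⊕-cong ≋-refl (⊛-· z cr E₁) ⟩
        E₁ · E₁ ⊕ z ⊛ (c₁ · r · E₁)             ≈⟨ ⊕-cong ≋-refl (⊛-cong refl
          (≋-trans (·-assoc c₁ r E₁) (≋-trans (·-congˡ rE₁) (·-⊛ y c₁ r)))) ⟩
        E₁ · E₁ ⊕ z ⊛ y ⊛ cr                    ≈⟨ ⊕-cong ≋-refl (⊛-⊛ z y cr) ⟩
        E₁ · E₁ ⊕ (z * y) ⊛ cr                  ∎

      E₂E₂ : E₂ · E₂ ≋ E₂
      E₂E₂ = begin
        E₂ · (E₁ ⊕ z ⊛ cr)                               ≈⟨ ·-⊕ E₂ E₁ (z ⊛ cr) ⟩
        E₂ · E₁ ⊕ E₂ · (z ⊛ cr)                          ≈⟨ ⊕-cong E₂E₁ (·-⊛ z E₂ cr) ⟩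
        (E₁ · E₁ ⊕ (z * y) ⊛ cr) ⊕ z ⊛ (E₂ · cr)         ≈⟨ ⊕-cong ≋-refl (⊛-cong refl
          (≋-trans (≋-sym (·-assoc E₂ c₁ r)) (≋-trans (·-congʳ E₂c) (⊛-· w c₁ r)))) ⟩
        (E₁ · E₁ ⊕ (z * y) ⊛ cr) ⊕ z ⊛ w ⊛ cr            ≈⟨ pointwise (λ i j → scalars _ (at cr i j)) ⟩
        (cr ⊕ E₁ · E₁) ⊕ z ⊛ cr                          ≈⟨ ⊕-cong E₁E₁ ≋-refl ⟩
        E₂                                               ∎
        where
        scalars : ∀ u v → (u + (z * y) * v) + z * (w * v) ≈ (v + u) + z * v
        scalars u v =
          trans (+-assoc _ _ _)
          (trans (+-congˡ (trans (+-congˡ (sym (*-assoc z w v))) (trans (sym (distribʳ v _ _))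
            (trans (*-congʳ zw₂) (trans (distribʳ v 1# z) (+-congʳ (*-identityˡ v)))))))
          (trans (sym (+-assoc u v _)) (+-congʳ (+-comm u v))))

    module _ (x′ : Carrier) (xx′ : x * x′ ≈ 1#) where
      private
        x′xy : x′ * (x * y) ≈ y
        x′xy = trans (sym (*-assoc _ _ _)) (trans (*-congʳ (trans (*-comm _ _) xx′)) (*-identityˡ y))

        1+x′y : 1# + x′ * y ≈ x′
        1+x′y = trans (+-cong (sym xx′) (*-comm x′ y)) (x+y-* x′)

      open Reduce (- x′) 0#
        (trans (+-cong refl (trans (sym (-‿distribˡ-* _ _)) (-‿cong x′xy))) (-‿inverseʳ y))
        (trans (+-cong (sym (-‿distribˡ-* _ _)) (zeroʳ _)) (trans (+-identityʳ _)
          (∙-cancelˡ x′ _ _ (trans (+-congʳ (sym 1+x′y)) (trans (+-assoc _ _ _)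
            (trans (+-congˡ (-‿inverseʳ _)) (trans (+-comm _ _) (trans (+-congʳ (sym (-‿inverseʳ x′)))
            (trans (+-assoc _ _ _) (+-congˡ (+-comm _ _)))))))))))

      -- `E₂` is the Schur complement of x in `E`, so the rank of `E` is one higher. The first
      -- column of `E` is the additional basis vector, with coordinate form (1, r / x); w = 0 makes
      -- it independent of the image of `E₂` in both directions.
      split-x : Splitting E₂ → Splitting E
      split-x s = record
        { rank    = suc rank
        ; inc     = inc′
        ; pro     = pro′
        ; inc-pro = pointwise λ i j → trans (∑-fin _) (inc-pro′ i j)
        ; pro-inc = pointwise λ i j → trans (∑-fin _) (pro-inc′ i j)
        }
        where
        open Splitting s

        inc′ : Mat (fin (suc n)) (fin (suc rank))
        inc′ = mat λ
          { Fin.zero    Fin.zero    → x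
          ; Fin.zero    (Fin.suc j) → 0#
          ; (Fin.suc i) Fin.zero    → at c₁ i Fin.zero
          ; (Fin.suc i) (Fin.suc j) → at inc i j
          }

        pro′ : Mat (fin (suc rank)) (fin (suc n))
        pro′ = mat λ
          { Fin.zero    Fin.zero    → 1#
          ; Fin.zero    (Fin.suc j) → x′ * at r Fin.zero j
          ; (Fin.suc i) Fin.zero    → 0#
          ; (Fin.suc i) (Fin.suc j) → at pro i j
          }

        r-inc : r · inc ≋ 𝟘
        r-inc = begin
          r · inc            ≈⟨ ·-congˡ E-inc ⟨
          r · (E₂ · inc)     ≈⟨ ·-assoc r E₂ inc ⟨
          r · E₂ · inc       ≈⟨ ·-congʳ rE₂ ⟩
          (0# ⊛ r) · inc     ≈⟨ ⊛-· 0# r inc ⟩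
          0# ⊛ (r · inc)     ≈⟨ pointwise (λ _ _ → zeroˡ _) ⟩
          𝟘                  ∎

        pro-c : pro · c₁ ≋ 𝟘
        pro-c = begin
          pro · c₁           ≈⟨ ·-congʳ pro-E ⟨
          pro · E₂ · c₁      ≈⟨ ·-assoc pro E₂ c₁ ⟩
          pro · (E₂ · c₁)    ≈⟨ ·-congˡ E₂c ⟩
          pro · (0# ⊛ c₁)    ≈⟨ ·-⊛ 0# pro c₁ ⟩
          0# ⊛ (pro · c₁)    ≈⟨ pointwise (λ _ _ → zeroˡ _) ⟩
          𝟘                  ∎

        inc-pro′ : ∀ i j → at inc′ i Fin.zero * at pro′ Fin.zero j
          + ∑ (fin rank) (λ k → at inc′ i (Fin.suc k) * at pro′ (Fin.suc k) j) ≈ at E i j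
        inc-pro′ Fin.zero    Fin.zero    =
          trans (+-cong (*-identityʳ x) (∑-0 (fin rank) λ _ → zeroʳ _)) (+-identityʳ x)
        inc-pro′ Fin.zero    (Fin.suc j) =
          trans (+-cong (trans (sym (*-assoc _ _ _)) (trans (*-congʳ xx′) (*-identityˡ _)))
                        (∑-0 (fin rank) λ _ → zeroˡ _)) (+-identityʳ _)
        inc-pro′ (Fin.suc i) Fin.zero    =
          trans (+-cong (*-identityʳ _) (∑-0 (fin rank) λ _ → zeroʳ _)) (+-identityʳ _)
        inc-pro′ (Fin.suc i) (Fin.suc j) =
          trans (+-cong (trans (x∙yz≈y∙xz _ _ _) (*-congˡ (sym (∑-fin₁ _)))) (entry inc-pro i j))
          (trans (+-comm _ _) (trans (+-assoc _ _ _) (trans (+-congˡ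
            (trans (sym (distribʳ _ (- x′) x′)) (trans (*-congʳ (-‿inverseˡ x′)) (zeroˡ _))))
            (+-identityʳ _))))

        pro-inc′ : ∀ i j → at pro′ i Fin.zero * at inc′ Fin.zero j
          + ∑ (fin n) (λ k → at pro′ i (Fin.suc k) * at inc′ (Fin.suc k) j) ≈ finEqual i j
        pro-inc′ Fin.zero    Fin.zero    =
          trans (+-cong (*-identityˡ x) (trans (∑-cong (fin n) λ _ → *-assoc _ _ _)
            (trans (∑-*ˡ (fin n) x′ _) (trans (*-congˡ (trans (entry rc Fin.zero Fin.zero) (*-identityʳ _)))
            x′xy)))) x+y
        pro-inc′ Fin.zero    (Fin.suc j) =
          trans (+-cong (zeroʳ _) (trans (∑-cong (fin n) λ _ → *-assoc _ _ _)
            (trans (∑-*ˡ (fin n) x′ _) (trans (*-congˡ (entry r-inc Fin.zero j)) (zeroʳ _)))))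
            (+-identityʳ _)
        pro-inc′ (Fin.suc i) Fin.zero    =
          trans (+-cong (zeroˡ _) (entry pro-c i Fin.zero)) (+-identityʳ _)
        pro-inc′ (Fin.suc i) (Fin.suc j) =
          trans (+-cong (zeroˡ _) (entry pro-inc i j)) (+-identityˡ _)

      reduced-x : Mat (fin n) (fin n)
      reduced-x = E₂

      reduced-x-idem : reduced-x · reduced-x ≋ reduced-x
      reduced-x-idem = E₂E₂

    module _ (y′ : Carrier) (yy′ : y * y′ ≈ 1#) where
      private
        y′y : y′ * y ≈ 1#
        y′y = trans (*-comm _ _) yy′

        y′xy : y′ * (x * y) ≈ x
        y′xy = trans (x∙yz≈y∙xz y′ x y) (trans (*-congˡ y′y) (*-identityʳ x))

      open Reduce y′ 1# (trans (+-congˡ y′xy) (trans (+-comm y x) x+y))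
                        (+-cong y′y (*-identityʳ y′))

      private
        E₂E₁≋E₁ : E₂ · E₁ ≋ E₁
        E₂E₁≋E₁ = begin
          E₂ · E₁                    ≈⟨ E₂E₁ ⟩
          E₁ · E₁ ⊕ (y′ * y) ⊛ cr    ≈⟨ ⊕-cong ≋-refl (≋-trans (⊛-cong y′y ≋-refl) (1-⊛ cr)) ⟩
          E₁ · E₁ ⊕ cr               ≈⟨ pointwise (λ _ _ → +-comm _ _) ⟩
          cr ⊕ E₁ · E₁               ≈⟨ E₁E₁ ⟩
          E₁                         ∎

      -- Here 1 - `E₂` is the Schur complement of y in 1 - `E`, so the rank of `E` itself is
      -- unchanged. A vector (u, v) fixed by `E` satisfies y u = r v, which gives the first row of
      -- `inc′`; `pro′` applies `pro` to the lower rows of `E`.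
      split-y : Splitting E₂ → Splitting E
      split-y s = record
        { rank    = rank
        ; inc     = inc′
        ; pro     = pro′
        ; inc-pro = pointwise inc-pro′
        ; pro-inc = pro-inc′
        }
        where
        open Splitting s

        inc′ : Mat (fin (suc n)) (fin rank)
        inc′ = mat λ
          { Fin.zero    j → y′ * at (r · inc) Fin.zero j
          ; (Fin.suc i) j → at inc i j
          }

        pro′ : Mat (fin rank) (fin (suc n))
        pro′ = mat λ
          { i Fin.zero    → at (pro · c₁) i Fin.zero
          ; i (Fin.suc j) → at (pro · E₁) i j
          }

        through : ∀ {I J} (M : Mat I (fin n)) (N : Mat (fin n) J) → M · inc · (pro · N) ≋ M · (E₂ · N)
        through M N = begin
          M · inc · (pro · N)        ≈⟨ ·-assoc M inc _ ⟩
          M · (inc · (pro · N))      ≈⟨ ·-congˡ (·-assoc inc pro N) ⟨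
          M · (inc · pro · N)        ≈⟨ ·-congˡ (·-congʳ inc-pro) ⟩
          M · (E₂ · N)               ∎

        E₂c≋c : E₂ · c₁ ≋ c₁
        E₂c≋c = ≋-trans E₂c (1-⊛ c₁)

        scaled : ∀ {J} (N : Mat (fin n) J) j →
                 ∑ (fin rank) (λ k → (y′ * at (r · inc) Fin.zero k) * at (pro · N) k j)
                 ≈ y′ * at (r · (E₂ · N)) Fin.zero j
        scaled N j = trans (∑-cong (fin rank) λ _ → *-assoc _ _ _)
          (trans (∑-*ˡ (fin rank) y′ _) (*-congˡ (entry (through r N) Fin.zero j)))

        inc-pro′ : ∀ i j → at (inc′ · pro′) i j ≈ at E i j
        inc-pro′ Fin.zero    Fin.zero    = trans (scaled c₁ Fin.zero)
          (trans (*-congˡ (entry (≋-trans (·-congˡ E₂c≋c) rc) Fin.zero Fin.zero))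
          (trans (*-congˡ (*-identityʳ _)) y′xy))
        inc-pro′ Fin.zero    (Fin.suc j) = trans (scaled E₁ j)
          (trans (*-congˡ (entry (≋-trans (·-congˡ E₂E₁≋E₁) rE₁) Fin.zero j))
          (trans (sym (*-assoc _ _ _)) (trans (*-congʳ y′y) (*-identityˡ _))))
        inc-pro′ (Fin.suc i) Fin.zero    =
          entry (≋-trans (≋-sym (·-assoc inc pro c₁)) (≋-trans (·-congʳ inc-pro) E₂c≋c)) i Fin.zero
        inc-pro′ (Fin.suc i) (Fin.suc j) =
          entry (≋-trans (≋-sym (·-assoc inc pro E₁)) (≋-trans (·-congʳ inc-pro) E₂E₁≋E₁)) i j

        pro-inc′ : pro′ · inc′ ≋ 𝟙
        pro-inc′ = begin
          pro′ · inc′                                        ≈⟨ pointwise (λ i j → trans (∑-fin _)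
            (trans (+-comm _ _) (+-congˡ (trans (x∙yz≈y∙xz _ _ _) (*-congˡ (sym (∑-fin₁ _))))))) ⟩
          pro · E₁ · inc ⊕ y′ ⊛ (pro · c₁ · (r · inc))       ≈⟨ ⊕-cong ≋-refl (⊛-cong refl
            (≋-trans (≋-sym (·-assoc (pro · c₁) r inc)) (·-congʳ (·-assoc pro c₁ r)))) ⟩
          pro · E₁ · inc ⊕ y′ ⊛ (pro · cr · inc)             ≈⟨ ⊕-cong ≋-refl
            (≋-trans (≋-sym (⊛-· y′ (pro · cr) inc)) (·-congʳ (≋-sym (·-⊛ y′ pro cr)))) ⟩
          pro · E₁ · inc ⊕ pro · (y′ ⊛ cr) · inc             ≈⟨ ⊕-· (pro · E₁) (pro · (y′ ⊛ cr)) inc ⟨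
          (pro · E₁ ⊕ pro · (y′ ⊛ cr)) · inc                 ≈⟨ ·-congʳ (·-⊕ pro E₁ (y′ ⊛ cr)) ⟨
          pro · E₂ · inc                                     ≈⟨ ·-congʳ pro-E ⟩
          pro · inc                                          ≈⟨ pro-inc ⟩
          𝟙                                                  ∎

      reduced-y : Mat (fin n) (fin n)
      reduced-y = E₂

      reduced-y-idem : reduced-y · reduced-y ≋ reduced-y
      reduced-y-idem = E₂E₂

  Local : Set (c ⊔ ℓ)
  Local = ∀ x y → x + y ≈ 1# → (∃[ x′ ] x * x′ ≈ 1#) ⊎ (∃[ y′ ] y * y′ ≈ 1#)

  abstract
    split : Local → ∀ n (E : Mat (fin n) (fin n)) → E · E ≋ E → Splitting E
    split local zero    E EE = record
      { rank    = 0
      ; inc     = mat λ ()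
      ; pro     = mat λ ()
      ; inc-pro = pointwise λ ()
      ; pro-inc = pointwise λ ()
      }
    split local (suc n) E EE =
      [ (λ (x′ , xx′) → split-x x′ xx′ (split local n (reduced-x x′ xx′) (reduced-x-idem x′ xx′)))
      , (λ (y′ , yy′) → split-y y′ yy′ (split local n (reduced-y y′ yy′) (reduced-y-idem y′ yy′)))
      ]′ (local (at E Fin.zero Fin.zero) y x+y)
      where
      y : Carrier
      y = 1# - at E Fin.zero Fin.zero

      x+y : at E Fin.zero Fin.zero + y ≈ 1#
      x+y = trans (+-comm _ _) (trans (+-assoc _ _ _) (trans (+-congˡ (-‿inverseˡ _)) (+-identityʳ _)))

      open Pivot E EE y x+y using (split-x; split-y; reduced-x; reduced-y; reduced-x-idem; reduced-y-idem)

occ : ℕ → List ℕ → ℕ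
occ b []       = 0
occ b (a ∷ as) with b ℕ.≟ a
... | yes _ = suc (occ b as)
... | no  _ = occ b as

occ-∈ : ∀ {b as} → b ∈ˡ as → ¬ (occ b as ≡ 0)
occ-∈ {b} {a ∷ as} b∈ with b ℕ.≟ a
... | yes _ = λ ()
occ-∈ {b} {a ∷ as} (here b≡a)  | no b≢a = contradiction b≡a b≢a
occ-∈ {b} {a ∷ as} (there b∈)  | no _   = occ-∈ b∈

-- Multiplicities and eigenspaces over the reals.

module RealSpectra {c ℓ₁ ℓ₂} (ℝ : Reals c ℓ₁ ℓ₂) where
  open Reals ℝ
  open Spectra ℝ hiding (_⊛_)
  open Matrices commutativeRing
  open Laplacians commutativeRing using (fin; finEqual)
  open Idempotents commutativeRing
  open CommutativeRing commutativeRing using (ring)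
  open RingProperties ring using (-‿distribˡ-*; -‿involutive)
  open HeytingProperties heytingCommutativeRing using (1#0; x-0≈x; #-congʳ)
  open IsStrictPartialOrder isStrictPartialOrder using (<-resp-≈; irrefl) renaming (trans to <-trans)
  open Index

  private
    -- 1 is apart from 0, hence comparable with it; if it were negative, it would still be positive
    -- as the square of the positive number -1.
    0<1 : 0# < 1#
    0<1 with Equivalence.to #⇔< 1#0
    ... | inj₂ 0<1 = 0<1
    ... | inj₁ 1<0 = proj₁ <-resp-≈ -1*-1 (*-pos 0<-1 0<-1)
      where
      0<-1 : 0# < - 1#
      0<-1 = proj₁ <-resp-≈ (+-identityˡ _) (proj₂ <-resp-≈ (-‿inverseʳ 1#) (+-monoˡ-< (- 1#) 1<0))

      -1*-1 : - 1# * - 1# ≈ 1#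
      -1*-1 = trans (sym (-‿distribˡ-* 1# _)) (trans (-‿cong (*-identityˡ _)) (-‿involutive 1#))

    ι-suc : ∀ n → ι n < ι (suc n)
    ι-suc n = proj₂ <-resp-≈ (+-identityˡ _) (+-monoˡ-< (ι n) 0<1)

    ι-<′ : ∀ {m n} → m ℕ.<′ n → ι m < ι n
    ι-<′ {m} (ℕ.≤′-reflexive ≡.refl) = ι-suc m
    ι-<′ {m} {suc n} (ℕ.≤′-step m<n) = <-trans (ι-<′ m<n) (ι-suc n)

  ι-# : ∀ {m n} → ¬ (m ≡ n) → ι m # ι n
  ι-# {m} {n} m≢n with ℕ.<-cmp m n
  ... | tri< m<n _ _ = Equivalence.from #⇔< (inj₁ (ι-<′ {m} {n} (ℕ.≤⇒≤′ m<n)))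
  ... | tri≈ _ m≡n _ = contradiction m≡n m≢n
  ... | tri> _ _ n<m = Equivalence.from #⇔< (inj₂ (ι-<′ {n} {m} (ℕ.≤⇒≤′ n<m)))

  ι-≥ : ∀ {m n} → n ℕ.≤ m → ι m ≥ ι n
  ι-≥ {m} {n} n≤m m<n with ℕ.m≤n⇒m<n∨m≡n n≤m
  ... | inj₁ n<m    = irrefl refl (<-trans (ι-<′ {n} {m} (ℕ.≤⇒≤′ n<m)) m<n)
  ... | inj₂ ≡.refl = irrefl refl m<n

  ≈⇒¬# : ∀ {x y} → x ≈ y → ¬ (x # y)
  ≈⇒¬# {x} {y} = proj₂ (tight x y)

  ¬#⇒≈ : ∀ {x y} → ¬ (x # y) → x ≈ y
  ¬#⇒≈ {x} {y} = proj₁ (tight x y)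

  ι-injective : ∀ {m n} → ι m ≈ ι n → m ≡ n
  ι-injective {m} {n} eq with m ℕ.≟ n
  ... | yes m≡n = m≡n
  ... | no  m≢n = contradiction (ι-# m≢n) (≈⇒¬# eq)

  inverse : ∀ {x} → x # 0# → ∃[ y ] x * y ≈ 1#
  inverse {x} x#0 with #⇒invertible x#0
  ... | y , _ , eq = y , trans (*-congʳ (sym (x-0≈x x))) eq

  inv : ℕ → Carrier
  inv a = proj₁ (inverse (ι-# {suc a} {0} λ ()))

  ι-inv : ∀ a → ι (suc a) * inv a ≈ 1#
  ι-inv a = proj₂ (inverse (ι-# {suc a} {0} λ ()))

  -- Cotransitivity of 1 # 0 at x makes x apart from 0 or from 1, and in the second case y = 1 - x
  -- is invertible.
  local : Local
  local x y x+y≈1 with #-cotrans 1#0 x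
  ... | inj₂ x#0 = inj₁ (inverse x#0)
  ... | inj₁ 1#x = inj₂ (inverse {y} (#-congʳ 1-x≈y (invertible⇒# 1-x-0)))
    where
    1-x≈y : 1# - x ≈ y
    1-x≈y = trans (+-congʳ (sym x+y≈1)) (trans (+-congʳ (+-comm x y))
      (trans (+-assoc _ _ _) (trans (+-congˡ (-‿inverseʳ x)) (+-identityʳ y))))

    1-x-0 = let z , l , r = #⇒invertible 1#x in
      z , trans (*-congˡ (x-0≈x _)) l , trans (*-congʳ (x-0≈x _)) r

  cancel : ∀ {x y z} → x # y → x * z ≈ y * z → z ≈ 0#
  cancel {x} {y} {z} x#y eq with #⇒invertible x#y
  ... | u , ul , _ = trans (sym (*-identityˡ z)) (trans (*-congʳ (sym ul))
    (trans (*-assoc _ _ _) (trans (*-congˡ (trans (distribʳ z x (- y))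
      (trans (+-cong eq (sym (-‿distribˡ-* y z))) (-‿inverseʳ _)))) (zeroʳ u))))

  -- Which integer x equals cannot be decided, but all except one can be excluded. The old candidate
  -- a is apart from n + 1, so x is apart from one of them, and the other remains as the candidate.
  locate : ∀ x n → ∃[ a ] a ℕ.≤ n × (∀ b → b ℕ.≤ n → ¬ (b ≡ a) → x # ι b)
  locate x zero    = 0 , ℕ.z≤n , λ { zero _ b≢0 → contradiction ≡.refl b≢0 }
  locate x (suc n) with locate x n
  ... | a , a≤n , apart with #-cotrans (ι-# {a} {suc n} (ℕ.<⇒≢ (ℕ.s≤s a≤n))) x
  ...   | inj₂ x#n = a , ℕ.m≤n⇒m≤1+n a≤n , λ b b≤ b≢a →
    [ (λ b≤n → apart b (ℕ.s≤s⁻¹ b≤n) b≢a) , (λ { ≡.refl → x#n }) ]′ (ℕ.m≤n⇒m<n∨m≡n b≤)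
  ...   | inj₁ a#x = suc n , ℕ.≤-refl , λ b b≤ b≢n →
    let b≤n = ℕ.s≤s⁻¹ (ℕ.≤∧≢⇒< b≤ b≢n) in all-apart b b≤n
    where
    all-apart : ∀ b → b ℕ.≤ n → x # ι b
    all-apart b b≤n with b ℕ.≟ a
    ... | yes ≡.refl = #-sym a#x
    ... | no  b≢a    = apart b b≤n b≢a

  Mult-unique : ∀ {x xs m n} → Mult x xs m → Mult x xs n → m ≡ n
  Mult-unique []          []          = ≡.refl
  Mult-unique (hit _ p)   (hit _ q)   = ≡.cong suc (Mult-unique p q)
  Mult-unique (hit e _)   (miss ¬e _) = contradiction e ¬e
  Mult-unique (miss ¬e _) (hit e _)   = contradiction e ¬e
  Mult-unique (miss _ p)  (miss _ q)  = Mult-unique p q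

  Mult-occ : ∀ {x b} → x ≈ ι b → ∀ t → Mult x (map ι t) (occ b t)
  Mult-occ         x≈b []      = []
  Mult-occ {b = b} x≈b (a ∷ t) with b ℕ.≟ a
  ... | yes ≡.refl = hit x≈b (Mult-occ x≈b t)
  ... | no  b≢a    = miss (λ x≈a → b≢a (ι-injective (trans (sym x≈b) x≈a))) (Mult-occ x≈b t)

  Mult-none : ∀ {x} t → (∀ {b} → b ∈ˡ t → ¬ (x ≈ ι b)) → Mult x (map ι t) 0
  Mult-none []      _ = []
  Mult-none (a ∷ t) f = miss (f (here ≡.refl)) (Mult-none t (f ∘ there))

  Mult-hit : ∀ {x m} t → Mult x (map ι t) m → (∃[ b ] b ∈ˡ t × x ≈ ι b) ⊎ m ≡ 0
  Mult-hit []      []         = inj₂ ≡.refl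
  Mult-hit (a ∷ t) (hit e _)  = inj₁ (a , here ≡.refl , e)
  Mult-hit (a ∷ t) (miss _ p) with Mult-hit t p
  ... | inj₁ (b , b∈ , e) = inj₁ (b , there b∈ , e)
  ... | inj₂ m≡0          = inj₂ m≡0

  -- If B and B′ are bases, with B′ = B Q and B = B′ Q′, then m = tr (Q Q′) = tr (Q′ Q) = m′.
  module _ {n ℓ} {V : Vector Carrier n → Set ℓ} where
    open HasDimension

    private
      basisMat : ∀ {m} → HasDimension V m → Mat (fin n) (fin m)
      basisMat h = mat λ i j → basis h j i

      coords : ∀ {m m′} → HasDimension V m → HasDimension V m′ → Mat (fin m) (fin m′)
      coords h h′ = mat λ j l → proj₁ (spanning h (basis h′ l) (basis⊆V h′ l)) j

      combination≈ : ∀ {m} (h : HasDimension V m) (a : Vector Carrier m) i →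
                     combination h (basis h) a i ≈ ∑ (fin m) (λ j → at (basisMat h) i j * a j)
      combination≈ {m} h a i = trans (sym (∑-sum (fin m) _)) (∑-cong (fin m) λ j → *-comm _ _)

      change : ∀ {m m′} (h : HasDimension V m) (h′ : HasDimension V m′) →
               basisMat h · coords h h′ ≋ basisMat h′
      change h h′ = pointwise λ i l → sym
        (trans (proj₂ (spanning h (basis h′ l) (basis⊆V h′ l)) i) (combination≈ h _ i))

      coords-inverse : ∀ {m m′} (h : HasDimension V m) (h′ : HasDimension V m′) →
                       coords h h′ · coords h′ h ≋ 𝟙
      coords-inverse {m} h h′ = pointwise λ j k →
        trans (sym (+-identityʳ _)) (trans (+-congˡ (sym (-‿inverseˡ _)))
        (trans (sym (+-assoc _ _ _))
        (trans (+-congʳ (independent h (λ j → at (Q ⊖ 𝟙) j k)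
                 (λ i → trans (combination≈ h _ i) (entry zero′ i k)) j)) (+-identityˡ _))))
        where
        Q = coords h h′ · coords h′ h

        zero′ : basisMat h · (Q ⊖ 𝟙) ≋ 𝟘
        zero′ = begin
          basisMat h · (Q ⊖ 𝟙)                   ≈⟨ ·-⊖ _ Q 𝟙 ⟩
          basisMat h · Q ⊖ basisMat h · 𝟙        ≈⟨ ⊖-cong
            (≋-trans (≋-sym (·-assoc (basisMat h) (coords h h′) (coords h′ h)))
              (≋-trans (·-congʳ (change h h′)) (change h′ h)))
            (·-𝟙 _) ⟩
          basisMat h ⊖ basisMat h                ≈⟨ ⊖-self _ ⟩
          𝟘                                      ∎

    dimension-unique : ∀ {m m′} → HasDimension V m → HasDimension V m′ → m ≡ m′
    dimension-unique {m} {m′} h h′ = ι-injective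
      (trans (sym (tr-𝟙 m)) (trans (tr-cong (≋-sym (coords-inverse h h′)))
      (trans (tr-comm (coords h h′) (coords h′ h)) (trans (tr-cong (coords-inverse h′ h)) (tr-𝟙 m′)))))

  ΣM-single : ∀ {I J} {f : ℕ → Mat I J} m {b} → b ℕ.< m → (∀ {a} → ¬ (a ≡ b) → f a ≋ 𝟘) → ΣM m f ≋ f b
  ΣM-single {f = f} (suc m) {zero}  b<m z = ≋-trans (⊕-cong ≋-refl (ΣM-zero m λ a → z λ ())) (⊕-𝟘 _)
  ΣM-single (suc m) {suc b} b<m z = ≋-trans
    (⊕-cong (z λ ()) (ΣM-single m (ℕ.s≤s⁻¹ b<m) (λ a≢b → z (a≢b ∘ ℕ.suc-injective)))) (𝟘-⊕ _)

  module Resolution {N} (M : Matrix N N) (n : ℕ) (P : ℕ → Mat (fin N) (fin N))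
                    (P-left  : ∀ b → mat M · P b ≋ ι b ⊛ P b)
                    (P-right : ∀ b → P b · mat M ≋ ι b ⊛ P b)
                    (P-sum   : ΣM (suc n) P ≋ 𝟙)
                    where

    private
      annihilate : ∀ {K x b} {V : Mat (fin N) K} → mat M · V ≋ x ⊛ V → x # ι b → P b · V ≋ 𝟘
      annihilate {x = x} {b} {V} MV x#b = pointwise λ i k → cancel x#b (sym (entry eq i k))
        where
        eq : ι b ⊛ (P b · V) ≋ x ⊛ (P b · V)
        eq = begin
          ι b ⊛ (P b · V)      ≈⟨ ⊛-· _ _ V ⟨
          (ι b ⊛ P b) · V      ≈⟨ ·-congʳ (P-right b) ⟨
          P b · mat M · V      ≈⟨ ·-assoc _ _ V ⟩
          P b · (mat M · V)    ≈⟨ ·-congˡ MV ⟩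
          P b · (x ⊛ V)        ≈⟨ ·-⊛ x _ V ⟩
          x ⊛ (P b · V)        ∎

      -- In the resolution of the identity, applied to `V`, all terms but the one at b vanish, since
      -- their integers are apart from x.
      eigenvector-fixed : ∀ {K x b} {V : Mat (fin N) K} → b ℕ.≤ n → x ≈ ι b → mat M · V ≋ x ⊛ V → P b · V ≋ V
      eigenvector-fixed {x = x} {b} {V} b≤n x≈b MV = begin
        P b · V                      ≈⟨ ΣM-single (suc n) (ℕ.s≤s b≤n)
          (λ {a} a≢b → annihilate {b = a} MV (#-congʳ (sym x≈b) (#-sym (ι-# {a} {b} a≢b)))) ⟨
        ΣM (suc n) (λ a → P a · V)   ≈⟨ ΣM-· (suc n) P V ⟨
        ΣM (suc n) P · V             ≈⟨ ·-congʳ P-sum ⟩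
        𝟙 · V                        ≈⟨ 𝟙-· V ⟩
        V                            ∎

      splitting : ∀ {b} → b ℕ.≤ n → Splitting (P b)
      -- The columns of `P b` are eigenvectors themselves, so this instance is the idempotence of
      -- `P b`.
      splitting {b} b≤n = split local N (P b) (eigenvector-fixed b≤n refl (P-left b))

    rank : ∀ {b} → b ℕ.≤ n → ℕ
    rank b≤n = Splitting.rank (splitting b≤n)

    tr-rank : ∀ {b} (b≤n : b ℕ.≤ n) → tr (P b) ≈ ι (rank b≤n)
    tr-rank b≤n = Splitting-tr (splitting b≤n)

    private
      column : ∀ {m} → Vector Carrier m → Mat (fin m) (fin 1)
      column v = mat λ i _ → v i

      column-eigen : ∀ {x v} → Eigenspace M x v → mat M · column v ≋ x ⊛ column v
      column-eigen e = pointwise λ i _ → trans (∑-sum (fin N) _) (e i)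

    eigenspace-dimension : ∀ {x b} (b≤n : b ℕ.≤ n) → x ≈ ι b → HasDimension (Eigenspace M x) (rank b≤n)
    eigenspace-dimension {x} {b} b≤n x≈b = record
      { basis       = λ j i → at inc i j
      ; basis⊆V     = λ j i → trans (sym (∑-sum (fin N) _)) (entry M-inc i j)
      ; independent = λ a z j → trans (sym (entry (𝟙-· (column a)) j Fin.zero))
          (entry (independent′ a z) j Fin.zero)
      ; spanning    = λ v e → (λ j → at (pro · column v) j Fin.zero) , λ i →
          trans (sym (entry (eigenvector-fixed b≤n x≈b (column-eigen e)) i Fin.zero))
          (trans (entry (≋-trans (·-congʳ (≋-sym inc-pro)) (·-assoc inc pro (column v))) i Fin.zero)
          (trans (∑-cong (fin _) λ _ → *-comm _ _) (∑-sum (fin _) _)))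
      }
      where
      open Splitting (splitting b≤n)

      M-inc : mat M · inc ≋ x ⊛ inc
      M-inc = begin
        mat M · inc             ≈⟨ ·-congˡ E-inc ⟨
        mat M · (P b · inc)     ≈⟨ ·-assoc _ _ inc ⟨
        mat M · P b · inc       ≈⟨ ·-congʳ (P-left b) ⟩
        (ι b ⊛ P b) · inc       ≈⟨ ⊛-· _ _ inc ⟩
        ι b ⊛ (P b · inc)       ≈⟨ ⊛-cong (sym x≈b) E-inc ⟩
        x ⊛ inc                 ∎

      independent′ : ∀ a → (∀ i → _ ≈ 0#) → 𝟙 · column a ≋ 𝟘
      independent′ a z = begin
        𝟙 · column a            ≈⟨ ·-congʳ pro-inc ⟨
        pro · inc · column a    ≈⟨ ·-assoc pro inc (column a) ⟩
        pro · (inc · column a)  ≈⟨ ·-congˡ {N′ = 𝟘} (pointwise λ i _ →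
          trans (∑-cong (fin _) λ _ → *-comm _ _) (trans (∑-sum (fin _) _) (z i))) ⟩
        pro · 𝟘                 ≈⟨ ·-𝟘 pro ⟩
        𝟘                       ∎

    -- The hypothesis is conditional on x ≈ ι b because that equation cannot be decided; it covers
    -- both the case that x is no candidate eigenvalue and the case of one with rank zero.
    trivial-eigenspace : ∀ {x} → (∀ {b} (b≤n : b ℕ.≤ n) → x ≈ ι b → rank b≤n ≡ 0) →
                         HasDimension (Eigenspace M x) 0
    trivial-eigenspace {x} none = record
      { basis       = λ ()
      ; basis⊆V     = λ ()
      ; independent = λ _ _ ()
      ; spanning    = λ v e → (λ ()) , λ i →
          trans (sym (entry (𝟙-· (column v)) i Fin.zero))
          (trans (sym (entry (≋-trans (≋-sym (ΣM-· (suc n) P (column v))) (·-congʳ P-sum)) i Fin.zero))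
                 (zeros (suc n) {λ b → P b · column v} {i} (λ b b≤n → vanish e b (ℕ.s≤s⁻¹ b≤n) i)))
      }
      where
      vanish : ∀ {v} → Eigenspace M x v → ∀ b → b ℕ.≤ n → ∀ i → at (P b · column v) i Fin.zero ≈ 0#
      -- By tightness it suffices to refute apartness from 0. That apartness forces x ≈ ι b, since
      -- otherwise `annihilate` applies; but then `P b` has rank zero and vanishes.
      vanish {v} e b b≤n i = ¬#⇒≈ λ Pv#0 → ≈⇒¬# (zero-if (x≈b Pv#0)) Pv#0
        where
        Pv : Carrier
        Pv = at (P b · column v) i Fin.zero

        x≈b : Pv # 0# → x ≈ ι b
        x≈b Pv#0 = ¬#⇒≈ λ x#b →
          ≈⇒¬# (entry (annihilate {b = b} (column-eigen e) x#b) i Fin.zero) Pv#0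

        zero-if : x ≈ ι b → Pv ≈ 0#
        zero-if x≈b =
          entry (≋-trans (·-congʳ (rank-0 (splitting b≤n) (none b≤n x≈b))) (𝟘-· (column v))) i Fin.zero

      zeros : ∀ m {f : ℕ → Mat (fin N) (fin 1)} {i} → (∀ b → b ℕ.< m → at (f b) i Fin.zero ≈ 0#) →
              at (ΣM m f) i Fin.zero ≈ 0#
      zeros zero    _ = refl
      zeros (suc m) z = trans (+-cong (z 0 (ℕ.s≤s ℕ.z≤n)) (zeros m (λ b b<m → z (suc b) (ℕ.s≤s b<m))))
                              (+-identityʳ _)

    module _ (t : List ℕ) (t≤n : ∀ {b} → b ∈ˡ t → b ℕ.≤ n)
             (occ-rank : ∀ {b} (b≤n : b ℕ.≤ n) → occ b t ≡ rank b≤n) where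

      -- A proof of `Mult` carries the decisions whether x equals the listed values. In the converse
      -- direction these must be extracted from the dimension: dimension zero excludes every member
      -- of `t`, and a positive dimension lets `locate` find the value.
      multiplicity : ∀ x m → Mult x (map ι t) m ⇔ HasDimension (Eigenspace M x) m
      multiplicity x m = mk⇔ to from
        where
        dim : ∀ {b} (b≤n : b ℕ.≤ n) → x ≈ ι b → HasDimension (Eigenspace M x) (rank b≤n)
        dim = eigenspace-dimension

        unique : ∀ {m m′} → HasDimension (Eigenspace M x) m → HasDimension (Eigenspace M x) m′ → m ≡ m′
        unique = dimension-unique

        to : ∀ {m} → Mult x (map ι t) m → HasDimension (Eigenspace M x) m
        to {m} mult = [ some , none ]′ (Mult-hit t mult)
          where
          occ≡m : ∀ {b} → x ≈ ι b → occ b t ≡ m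
          occ≡m {b} x≈b = Mult-unique (Mult-occ {b = b} x≈b t) mult

          some : (∃[ b ] b ∈ˡ t × x ≈ ι b) → HasDimension (Eigenspace M x) m
          some (b , b∈ , x≈b) = ≡.subst (HasDimension (Eigenspace M x))
            (≡.trans (≡.sym (occ-rank (t≤n b∈))) (occ≡m {b} x≈b)) (dim (t≤n b∈) x≈b)

          none : m ≡ 0 → HasDimension (Eigenspace M x) m
          none m≡0 = ≡.subst (HasDimension (Eigenspace M x)) (≡.sym m≡0)
            (trivial-eigenspace λ {b} b≤n x≈b →
              ≡.trans (≡.sym (occ-rank b≤n)) (≡.trans (occ≡m {b} x≈b) m≡0))

        from : ∀ {m} → HasDimension (Eigenspace M x) m → Mult x (map ι t) m
        from {zero}  h = Mult-none t λ {b} b∈ x≈b → occ-∈ b∈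
          (≡.trans (occ-rank (t≤n b∈)) (unique (dim (t≤n b∈) x≈b) h))
        from {suc m} h = located (locate x n)
          where
          located : (∃[ a ] a ℕ.≤ n × (∀ b → b ℕ.≤ n → ¬ (b ≡ a) → x # ι b)) → Mult x (map ι t) (suc m)
          located (a , a≤n , apart) = ≡.subst (Mult x (map ι t))
            (≡.trans (occ-rank a≤n) (unique (dim a≤n x≈a) h)) (Mult-occ {b = a} x≈a t)
            where
            all-apart : x # ι a → ∀ b → b ℕ.≤ n → x # ι b
            all-apart x#a b b≤n with b ℕ.≟ a
            ... | yes ≡.refl = x#a
            ... | no  b≢a    = apart b b≤n b≢a

            -- Were x apart from the remaining candidate too, the eigenspace would be trivial,
            -- against its positive dimension.
            x≈a : x ≈ ι a
            x≈a = ¬#⇒≈ λ x#a → contradiction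
              (unique h (trivial-eigenspace λ {b} b≤n x≈b → contradiction (all-apart x#a b b≤n) (≈⇒¬# x≈b)))
              λ ()

-- Multiplicities in the conjugate of a partition.

above : ℕ → List ℕ → ℕ
above j ds = length (filter (suc j ℕ.≤?_) ds)

occ-++ : ∀ b as as′ → occ b (as ++ as′) ≡ occ b as ℕ.+ occ b as′
occ-++ b []       as′ = ≡.refl
occ-++ b (a ∷ as) as′ with b ℕ.≟ a
... | yes _ = ≡.cong suc (occ-++ b as as′)
... | no  _ = occ-++ b as as′

occ-suc : ∀ b (f : ℕ → ℕ) m → occ (suc b) (applyUpTo (suc ∘ f) m) ≡ occ b (applyUpTo f m)
occ-suc b f zero    = ≡.refl
occ-suc b f (suc m) with b ℕ.≟ f 0 | suc b ℕ.≟ suc (f 0)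
... | yes _  | yes _ = ≡.cong suc (occ-suc b (f ∘ suc) m)
... | no _   | no _  = occ-suc b (f ∘ suc) m
... | yes eq | no ne = contradiction (≡.cong suc eq) ne
... | no ne  | yes eq = contradiction (ℕ.suc-injective eq) ne

occ-0 : ∀ (f : ℕ → ℕ) m → occ 0 (applyUpTo (suc ∘ f) m) ≡ 0
occ-0 f zero    = ≡.refl
occ-0 f (suc m) = occ-0 (f ∘ suc) m

occ-zeros : ∀ {f : ℕ → ℕ} m → (∀ j → f j ≡ 0) → occ 0 (applyUpTo f m) ≡ m
occ-zeros         zero    z = ≡.refl
occ-zeros {f = f} (suc m) z with 0 ℕ.≟ f 0
... | yes _  = ≡.cong suc (occ-zeros m (z ∘ suc))
... | no  ne = contradiction (≡.sym (z 0)) ne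

occ-suc-zeros : ∀ {f : ℕ → ℕ} b m → (∀ j → f j ≡ 0) → occ (suc b) (applyUpTo f m) ≡ 0
occ-suc-zeros         b zero    z = ≡.refl
occ-suc-zeros {f = f} b (suc m) z with suc b ℕ.≟ f 0
... | no _   = occ-suc-zeros b m (z ∘ suc)
... | yes eq = contradiction (≡.trans eq (z 0)) λ ()

module _ {a} {A : Set a} where

  applyUpTo-+ : ∀ (f : ℕ → A) m n → applyUpTo f (m ℕ.+ n) ≡ applyUpTo f m ++ applyUpTo (f ∘ (m ℕ.+_)) n
  applyUpTo-+ f zero    n = ≡.refl
  applyUpTo-+ f (suc m) n = ≡.cong (f 0 ∷_) (applyUpTo-+ (f ∘ suc) m n)

  applyUpTo-cong : ∀ {f g : ℕ → A} m → (∀ {j} → j ℕ.< m → f j ≡ g j) → applyUpTo f m ≡ applyUpTo g m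
  applyUpTo-cong zero    eq = ≡.refl
  applyUpTo-cong (suc m) eq = ≡.cong₂ _∷_ (eq (ℕ.s≤s ℕ.z≤n)) (applyUpTo-cong m (eq ∘ ℕ.s≤s))

Antitone : (ℕ → ℕ) → Set
Antitone d = ∀ b → d (suc b) ℕ.≤ d b

antitone-0 : ∀ {d} → Antitone d → ∀ b → d b ℕ.≤ d 0
antitone-0 anti zero    = ℕ.≤-refl
antitone-0 anti (suc b) = ℕ.≤-trans (anti b) (antitone-0 anti b)

above-none : ∀ n {d j} → Antitone d → d 0 ℕ.≤ j → above j (applyUpTo d n) ≡ 0
above-none n {d} {j} anti d₀≤j = ≡.cong length (filter-none (suc j ℕ.≤?_)
  (Allₚ.applyUpTo⁺₂ d n λ b → ℕ.≤⇒≯ (ℕ.≤-trans (antitone-0 anti b) d₀≤j)))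

above-accept : ∀ {j d} ds → j ℕ.< d → above j (d ∷ ds) ≡ suc (above j ds)
above-accept {j} ds j<d = ≡.cong length (filter-accept (suc j ℕ.≤?_) j<d)

above-reject : ∀ {j d} ds → ¬ (j ℕ.< d) → above j (d ∷ ds) ≡ above j ds
above-reject {j} ds j≮d = ≡.cong length (filter-reject (suc j ℕ.≤?_) j≮d)

above-antitone : ∀ ds → Antitone (λ j → above j ds)
above-antitone []       j = ℕ.z≤n
above-antitone (d ∷ ds) j with suc j ℕ.<? d | j ℕ.<? d
... | yes p | yes q = ≡.subst₂ ℕ._≤_ (≡.sym (above-accept ds p)) (≡.sym (above-accept ds q))
                        (ℕ.s≤s (above-antitone ds j))
... | yes p | no ¬q = contradiction (ℕ.<⇒≤ p) ¬q
... | no ¬p | yes q = ≡.subst₂ ℕ._≤_ (≡.sym (above-reject ds ¬p)) (≡.sym (above-accept ds q))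
                        (ℕ.m≤n⇒m≤1+n (above-antitone ds j))
... | no ¬p | no ¬q = ≡.subst₂ ℕ._≤_ (≡.sym (above-reject ds ¬p)) (≡.sym (above-reject ds ¬q))
                        (above-antitone ds j)

-- For d₀ ≥ d₁ ≥ ⋯ and m ≥ d₀, this is the conjugate of (d₀ , … , dₙ₋₁), padded with zeros to length m.
padded : ℕ → (ℕ → ℕ) → ℕ → List ℕ
padded n d m = applyUpTo (λ j → above j (applyUpTo d n)) m

module _ (n : ℕ) {d : ℕ → ℕ} (anti : Antitone d) where

  private
    d′ : ℕ → ℕ
    d′ = d ∘ suc

    -- Removing the part d₀ lowers the first d₀ parts of the conjugate by one.
    padded-suc : ∀ k → padded (suc n) d (d 0 ℕ.+ k) ≡
      applyUpTo (λ j → suc (above j (applyUpTo d′ n))) (d 0)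
      ++ applyUpTo (λ j → above (d 0 ℕ.+ j) (applyUpTo d (suc n))) k
    padded-suc k = ≡.trans (applyUpTo-+ _ (d 0) k) (≡.cong
      (_++ applyUpTo (λ j → above (d 0 ℕ.+ j) (applyUpTo d (suc n))) k)
      (applyUpTo-cong (d 0) λ {j} j<d₀ → above-accept (applyUpTo d′ n) j<d₀))

    rest-0 : ∀ j → above (d 0 ℕ.+ j) (applyUpTo d (suc n)) ≡ 0
    rest-0 j = above-none (suc n) anti (ℕ.m≤m+n (d 0) j)

  occ-padded-0 : ∀ k → occ 0 (padded (suc n) d (d 0 ℕ.+ k)) ≡ k
  occ-padded-0 k = ≡.trans (≡.cong (occ 0) (padded-suc k)) (≡.trans
    (occ-++ 0 (applyUpTo (λ j → suc (above j (applyUpTo d′ n))) (d 0)) _)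
    (≡.cong₂ ℕ._+_ (occ-0 _ (d 0)) (occ-zeros k rest-0)))

  occ-padded-suc : ∀ b k → occ (suc b) (padded (suc n) d (d 0 ℕ.+ k)) ≡ occ b (padded n d′ (d 0))
  occ-padded-suc b k = ≡.trans (≡.cong (occ (suc b)) (padded-suc k)) (≡.trans
    (occ-++ (suc b) (applyUpTo (λ j → suc (above j (applyUpTo d′ n))) (d 0)) _)
    (≡.trans (≡.cong₂ ℕ._+_ (occ-suc b _ (d 0)) (occ-suc-zeros b k rest-0)) (ℕ.+-identityʳ _)))

-- Below `d 0` the largest part is counted in every entry; from `d 0` on no part is.
occ-0-padded : ∀ n {d m} → Antitone d → d n ≡ 0 → d 0 ℕ.≤ m → occ 0 (padded n d m) ℕ.+ d 0 ≡ m
occ-0-padded zero {d} {m} anti d₀≡0 d₀≤m =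
  ≡.trans (≡.cong₂ ℕ._+_ (occ-zeros m λ _ → ≡.refl) d₀≡0) (ℕ.+-identityʳ m)
occ-0-padded (suc n) {d} {m} anti dₙ≡0 d₀≤m with ℕ.m≤n⇒∃[o]m+o≡n d₀≤m
... | k , ≡.refl = ≡.trans (≡.cong (ℕ._+ d 0) (occ-padded-0 n anti k)) (ℕ.+-comm k (d 0))

-- A column of the Young diagram has height b + 1 when it meets row b but not row b + 1, with rows
-- numbered from 0. The induction removes the first row.
occ-suc-padded : ∀ n {d m} → Antitone d → d n ≡ 0 → d 0 ℕ.≤ m →
                 ∀ b → occ (suc b) (padded n d m) ℕ.+ d (suc b) ≡ d b
occ-suc-padded zero {d} {m} anti d₀≡0 d₀≤m b =
  ≡.trans (≡.cong₂ ℕ._+_ (occ-suc-zeros b m λ _ → ≡.refl) (d≡0 (suc b))) (≡.sym (d≡0 b))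
  where
  d≡0 : ∀ b → d b ≡ 0
  d≡0 b = ℕ.n≤0⇒n≡0 (ℕ.≤-trans (antitone-0 anti b) (ℕ.≤-reflexive d₀≡0))
occ-suc-padded (suc n) {d} anti dₙ≡0 d₀≤m b with ℕ.m≤n⇒∃[o]m+o≡n d₀≤m
occ-suc-padded (suc n) {d} anti dₙ≡0 d₀≤m zero    | k , ≡.refl =
  ≡.trans (≡.cong (ℕ._+ d 1) (occ-padded-suc n anti 0 k))
          (occ-0-padded n (anti ∘ suc) dₙ≡0 (anti 0))
occ-suc-padded (suc n) {d} anti dₙ≡0 d₀≤m (suc b) | k , ≡.refl =
  ≡.trans (≡.cong (ℕ._+ d (suc (suc b))) (occ-padded-suc n anti (suc b) k))
          (occ-suc-padded n (anti ∘ suc) dₙ≡0 (anti 0) b)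

tabulate-applyUpTo : ∀ {a} {A : Set a} n (f : ℕ → A) → tabulate {n = n} (f ∘ Fin.toℕ) ≡ applyUpTo f n
tabulate-applyUpTo zero    f = ≡.refl
tabulate-applyUpTo (suc n) f = ≡.cong (f 0 ∷_) (tabulate-applyUpTo n (f ∘ suc))

conjugate-↭ : ∀ n {d ds} → Antitone d → d n ≡ 0 → ds ↭ applyUpTo d n → conjugate ds ≡ padded n d (d 0)
conjugate-↭ n {d} {ds} anti dₙ≡0 ds↭ =
  ≡.trans (map-cong (λ j → ↭-length (filter-↭ (suc j ℕ.≤?_) ds↭)) _)
  (≡.trans (map-upTo (λ j → above j (applyUpTo d n)) _) (≡.cong (applyUpTo _) max≡d₀))
  where
  -- For n = 0 the maximum is the default value 0, which is `d 0` because d vanishes at n.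
  largest : ∀ n → d n ≡ 0 → d 0 ℕ.≤ 0 ⊎ Any (d 0 ℕ.≤_) (applyUpTo d n)
  largest zero    d₀≡0 = inj₁ (ℕ.≤-reflexive d₀≡0)
  largest (suc n) _    = inj₂ (here ℕ.≤-refl)

  transport : d 0 ℕ.≤ 0 ⊎ Any (d 0 ℕ.≤_) (applyUpTo d n) → d 0 ℕ.≤ 0 ⊎ Any (d 0 ℕ.≤_) ds
  transport (inj₁ p) = inj₁ p
  transport (inj₂ p) = inj₂ (Any-resp-↭ (↭-sym ds↭) p)

  max≡d₀ : max 0 ds ≡ d 0
  max≡d₀ = ℕ.≤-antisym
    (max≤v⁺ ℕ.z≤n (All-resp-↭ (↭-sym ds↭) (Allₚ.applyUpTo⁺₂ d n (antitone-0 anti))))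
    (v≤max⁺ 0 ds (transport (largest n dₙ≡0)))

degreeSequence-↭ : ∀ {n k} (K : Family n (suc k)) (K′ K″ : Family n k) → SamePair K K′ K″ →
                   degreeSequence K K′ ↭ applyUpTo (deg n (member K) (member K″)) n
degreeSequence-↭ {n} K K′ K″ same = ↭-trans (sort-↭ _) (↭-reflexive
  (≡.trans (map-cong (degree-deg K K′ K″ same) (allFin n))
  (≡.trans (map-tabulate id _) (tabulate-applyUpTo n _))))
  where open Sort (Flip.decTotalOrder ℕ.≤-decTotalOrder) using (sort-↭)

-- The spectrum of the Laplacian and its comparison with the conjugate.

module _ {c ℓ₁ ℓ₂} (ℝ : Reals c ℓ₁ ℓ₂) where
  open Reals ℝ hiding (_<_)
  open Spectra ℝ hiding (_⊛_)
  open Matrices commutativeRing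
  open Laplacians commutativeRing
  open Idempotents commutativeRing using (tr-𝟙)
  open RealSpectra ℝ

  Mult-++ : ∀ {x m xs ys} → All (λ y → ¬ (x ≈ y)) ys → Mult x (xs ++ ys) m ⇔ Mult x xs m
  Mult-++ {x} {ys = ys} none = mk⇔ (restrict′ _) extend
    where
    misses : ∀ {ys m} → All (λ y → ¬ (x ≈ y)) ys → Mult x ys m → m ≡ 0
    misses []        []         = ≡.refl
    misses (ne ∷ _)  (hit e _)  = contradiction e ne
    misses (_ ∷ nes) (miss _ p) = misses nes p

    restrict′ : ∀ xs {m} → Mult x (xs ++ ys) m → Mult x xs m
    restrict′ []       p          = ≡.subst (Mult x []) (≡.sym (misses none p)) []
    restrict′ (_ ∷ xs) (hit e p)  = hit e (restrict′ xs p)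
    restrict′ (_ ∷ xs) (miss e p) = miss e (restrict′ xs p)

    none-0 : ∀ {ys} → All (λ y → ¬ (x ≈ y)) ys → Mult x ys 0
    none-0 []         = []
    none-0 (ne ∷ nes) = miss ne (none-0 nes)

    extend : ∀ {xs m} → Mult x xs m → Mult x (xs ++ ys) m
    extend []         = none-0 none
    extend (hit e p)  = hit e (extend p)
    extend (miss e p) = miss e (extend p)

  module _ {n k} (K : Family n (suc k)) (K′ K″ : Family n k) (same : SamePair K K′ K″)
           (K↓ : Closed (member K)) (K″↓ : Closed (member K″)) where

    private
      N : ℕ
      N = card K

      d : ℕ → ℕ
      d = deg n (member K) (member K″)

      L : Mat (fin N) (fin N)
      L = mat (laplacian K K′)

      E : ℕ → Mat (fin N) (fin N)
      E = projection K K′ K″ same inv ι-inv K↓ K″↓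

      E-eigen : Eigen L E
      E-eigen = projection-Eigen K K′ K″ same inv ι-inv K↓ K″↓

      LΣ : L · ΣM n E ≋ L
      LΣ = projection-complete K K′ K″ same inv ι-inv K↓ K″↓

      E-tr : ∀ a → tr (E a) + ι (d (suc a)) ≈ ι (d a)
      E-tr = projection-tr K K′ K″ same inv ι-inv K↓ K″↓

      -- `raise` serves here to adjoin the projection onto the kernel as `P 0` and to renumber, so
      -- that `P b` belongs to the eigenvalue b of `L`.
      P : ℕ → Mat (fin N) (fin N)
      P = raise n 𝟙 E

      0-⊛ : (M : Mat (fin N) (fin N)) → 0# ⊛ M ≋ 𝟘
      0-⊛ M = pointwise λ _ _ → zeroˡ _

      P-left : ∀ b → L · P b ≋ ι b ⊛ P b
      P-left zero    = ≋-trans (·-⊖ L 𝟙 _) (≋-trans (⊖-cong (·-𝟙 L) LΣ)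
        (≋-trans (⊖-self L) (≋-sym (0-⊛ _))))
      P-left (suc a) = left E-eigen a

      P-right : ∀ b → P b · L ≋ ι b ⊛ P b
      P-right zero    = ≋-trans (⊖-· 𝟙 _ L) (≋-trans
        (⊖-cong (𝟙-· L) (≋-trans (≋-sym (ΣM-left≋right E-eigen n)) LΣ))
        (≋-trans (⊖-self L) (≋-sym (0-⊛ _))))
      P-right (suc a) = right E-eigen a

      module Res = Resolution (laplacian K K′) n P P-left P-right (ΣM-raise n 𝟙 E)
      open Res using (rank; tr-rank)

      dₙ≡0 : d n ≡ 0
      dₙ≡0 = deg-vanish n (member K) (member K″) ℕ.≤-refl

      rank-0-eq : rank ℕ.z≤n ℕ.+ d 0 ≡ N
      rank-0-eq = ι-injective
        (trans (ι-+ (rank ℕ.z≤n) (d 0))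
        (trans (+-cong (sym (tr-rank ℕ.z≤n)) (sym tr-Σ))
        (trans (sym (tr-⊕ (P 0) (ΣM n E)))
        (trans (tr-cong (ΣM-raise n 𝟙 E)) (tr-𝟙 N)))))
        where
        tr-Σ : tr (ΣM n E) ≈ ι (d 0)
        tr-Σ = trans (sym (+-identityʳ _)) (trans (+-congˡ (reflexive (≡.cong ι (≡.sym dₙ≡0))))
          (tr-telescope E d E-tr n))

      rank-suc-eq : ∀ {a} (a<n : suc a ℕ.≤ n) → rank a<n ℕ.+ d (suc a) ≡ d a
      rank-suc-eq {a} a<n = ι-injective
        (trans (ι-+ (rank a<n) (d (suc a))) (trans (+-congʳ (sym (tr-rank a<n))) (E-tr a)))

      -- The difference of consecutive degrees is the rank of a projection, hence a natural number.
      d-antitone : Antitone d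
      d-antitone b with ℕ.<-≤-connex b n
      ... | inj₁ b<n = ≡.subst (d (suc b) ℕ.≤_) (rank-suc-eq b<n) (ℕ.m≤n+m _ _)
      ... | inj₂ n≤b = ≡.subst (ℕ._≤ d b)
        (≡.sym (deg-vanish n (member K) (member K″) (ℕ.m≤n⇒m≤1+n n≤b))) ℕ.z≤n

      d₀≤N : d 0 ℕ.≤ N
      d₀≤N = ≡.subst (d 0 ℕ.≤_) rank-0-eq (ℕ.m≤n+m _ _)

      -- Padding to length `N` supplies the eigenvalue 0 with the multiplicity N - d 0, the
      -- dimension of the kernel.
      t : List ℕ
      t = padded n d N

      t≤n : ∀ {b} → b ∈ˡ t → b ℕ.≤ n
      t≤n = All.lookup (Allₚ.applyUpTo⁺₂ _ N λ j →
        ℕ.≤-trans (length-filter (suc j ℕ.≤?_) (applyUpTo d n)) (ℕ.≤-reflexive (length-applyUpTo d n)))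

      occ-rank : ∀ {b} (b≤n : b ℕ.≤ n) → occ b t ≡ rank b≤n
      occ-rank {zero}  ℕ.z≤n = ℕ.+-cancelʳ-≡ (d 0) _ _
        (≡.trans (occ-0-padded n d-antitone dₙ≡0 d₀≤N) (≡.sym rank-0-eq))
      occ-rank {suc a} a<n   = ℕ.+-cancelʳ-≡ (d (suc a)) _ _
        (≡.trans (occ-suc-padded n d-antitone dₙ≡0 d₀≤N a) (≡.sym (rank-suc-eq a<n)))

    spectrum : IsSpectrum (laplacian K K′) (map ι t)
    spectrum = record
      { decreasing   = Linkedₚ.map⁺ (Linkedₚ.applyUpTo⁺₂ _ N λ j → ι-≥ (above-antitone (applyUpTo d n) j))
      ; total        = ≡.trans (length-map ι t) (length-applyUpTo _ N)
      ; multiplicity = Res.multiplicity t t≤n occ-rank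
      }

    -- The two lists differ by the padding zeros, and an x apart from 0 equals none of them.
    spectrum≗conjugate : map ι t ≗ map ι (conjugate (degreeSequence K K′))
    spectrum≗conjugate x x#0 m = ≡.subst₂ (λ ys zs → Mult x ys m ⇔ Mult x zs m)
      (≡.sym (≡.trans (≡.cong (map ι) t≡) (map-++ ι (padded n d (d 0)) zeros)))
      (≡.cong (map ι) (≡.sym (conjugate-↭ n d-antitone dₙ≡0 (degreeSequence-↭ K K′ K″ same))))
      (Mult-++ (Allₚ.map⁺ (Allₚ.applyUpTo⁺₂ _ (N ℕ.∸ d 0) λ j x≈ →
        ≈⇒¬# (trans x≈ (≡.subst (λ b → ι b ≈ 0#) (≡.sym (zero-above j)) refl)) x#0)))
      where
      zeros : List ℕ
      zeros = applyUpTo (λ j → above (d 0 ℕ.+ j) (applyUpTo d n)) (N ℕ.∸ d 0)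

      zero-above : ∀ j → above (d 0 ℕ.+ j) (applyUpTo d n) ≡ 0
      zero-above j = above-none n d-antitone (ℕ.m≤m+n (d 0) j)

      t≡ : t ≡ padded n d (d 0) ++ zeros
      t≡ = ≡.trans (≡.cong (padded n d) (≡.sym (ℕ.m+[n∸m]≡n d₀≤N)))
                   (applyUpTo-+ _ (d 0) (N ℕ.∸ d 0))

theorem5p7 : ∀ {c ℓ₁ ℓ₂} (ℝ : Reals c ℓ₁ ℓ₂) (E : GroundSet) (k : ℕ) →
    let open Spectra ℝ
        open Reals ℝ using (fromℕ)
        open GroundSet E using (size)
    in
    (K : Family size (suc k)) (K′ : Family size k) →
    IsShiftedPair E K K′ →
    ∃[ s ] (IsSpectrum (laplacian K K′) s × s ≗ map fromℕ (conjugate (degreeSequence K K′)))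
theorem5p7 ℝ E k K K′ (K-shifted , K″ , same , K″-shifted) =
  _ , spectrum ℝ K K′ K″ same K↓ K″↓ , spectrum≗conjugate ℝ K K′ K″ same K↓ K″↓
  where
  K↓ : Closed (member K)
  K↓ = shifted⇒closed E K K-shifted

  K″↓ : Closed (member K″)
  K″↓ = shifted⇒closed E K″ K″-shifted
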